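{- Let $m>1$ and $\pi_1,\pi_2\in S_m$. For $n\ge m$, let $X_{\pi_1},X_{\pi_2}$ be the random variables on $S_n$ (uniform distribution) with $X_{\pi}(\tau)$ the number of occurrences of $\pi$ in $\tau$. Then, as $n\to\infty$, $$\mathrm{Cov}(X_{\pi_1},X_{\pi_2})=c(\pi_1,\pi_2)\, n^{2m-1}+O(n^{2m-2}),$$ where $$c(\pi_1,\pi_2)=\frac{1}{((2m-1)!)^2}\left(\mathrm{Tr}(A_mP_{\pi_1}A_mP_{\pi_2}^{ -1})-\binom{2m-1}{m-1}^2\right),$$ and $$\mathrm{Tr}(A_mP_{\pi_1}A_mP_{\pi_2}^{ -1})=\sum_{i,j=1}^{m}[i,j]_m\,[\pi_1(i),\pi_2(j)]_m.$$
   Context: An occurrence of $\pi\in S_m$ in $\tau\in S_n$ is a set of $m$ positions of $\tau$ such that the subsequence of $\tau$ at those positions is order-isomorphic to $\pi$. $P_\pi=[\delta(\pi(i),j)]_{m\times m}$ is the permutation matrix of $\pi$ ($\delta$ the Kronecker delta). For integers $1\le i,j\le m$, $[i,j]_m=\binom{i-1+j-1}{i-1}\binom{m-i+m-j}{m-i}$, and $A_m$ is the $m\times m$ matrix with $(A_m)_{ij}=[i,j]_m$. -}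

module Defs where

open import Data.Nat using (ℕ; zero; suc; _+_; _*_; _∸_; _^_; _!)
  renaming (_<ᵇ_ to _<ᵇ_; _≡ᵇ_ to _≡ᵇ_)
open import Data.Nat.Properties using (_!≢0; _!*_!≢0)
open import Data.Nat.Combinatorics using (_C_)
open import Data.Bool using (Bool; true; false; _∧_; _∨_; not; if_then_else_)
open import Data.Fin using (Fin; zero; suc; toℕ)
open import Data.Fin.Permutation using (Permutation′; _⟨$⟩ʳ_; flip)
open import Data.List using (List; []; _∷_; [_]; map; concatMap; allFin; filterᵇ; length)
open import Data.Bool.ListAction using (and)
open import Data.Nat.ListAction using (sum)
open import Data.Integer as ℤ using (ℤ; +_)
open import Data.Rational as ℚ using (ℚ; _/_)

_==ᵇ_ : Bool → Bool → Bool
true  ==ᵇ b = b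
false ==ᵇ b = not b

allPairs : (k : ℕ) → (Fin k → Fin k → Bool) → Bool
allPairs k p = and (concatMap (λ i → map (λ j → p i j) (allFin k)) (allFin k))

consF : ∀ {n k} → Fin k → (Fin n → Fin k) → Fin (suc n) → Fin k
consF a f zero    = a
consF a f (suc i) = f i

allFuns : (n k : ℕ) → List (Fin n → Fin k)
allFuns zero    k = [ (λ ()) ]
allFuns (suc n) k = concatMap (λ a → map (consF a) (allFuns n k)) (allFin k)

injectiveᵇ : ∀ {n} → (Fin n → Fin n) → Bool
injectiveᵇ {n} τ = allPairs n (λ i j → not (toℕ (τ i) ≡ᵇ toℕ (τ j)) ∨ (toℕ i ≡ᵇ toℕ j))

Sym : (n : ℕ) → List (Fin n → Fin n)
Sym n = filterᵇ injectiveᵇ (allFuns n n)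

-- strictly increasing maps Fin m → Fin n  =  m-element sets of positions of [n]
increasingᵇ : ∀ {m n} → (Fin m → Fin n) → Bool
increasingᵇ {m} f = allPairs m (λ i j → not (toℕ i <ᵇ toℕ j) ∨ (toℕ (f i) <ᵇ toℕ (f j)))

positionSets : (m n : ℕ) → List (Fin m → Fin n)
positionSets m n = filterᵇ increasingᵇ (allFuns m n)

isOccurrenceᵇ : ∀ {m n} → Permutation′ m → (Fin n → Fin n) → (Fin m → Fin n) → Bool
isOccurrenceᵇ {m} π τ f =
  allPairs m (λ a b → (toℕ (τ (f a)) <ᵇ toℕ (τ (f b))) ==ᵇ (toℕ (π ⟨$⟩ʳ a) <ᵇ toℕ (π ⟨$⟩ʳ b)))

X : ∀ {m n} → Permutation′ m → (Fin n → Fin n) → ℕ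
X {m} {n} π τ = length (filterᵇ (isOccurrenceᵇ π τ) (positionSets m n))

E : (n : ℕ) → ((Fin n → Fin n) → ℕ) → ℚ
E n g = (+ sum (map g (Sym n))) / (n !) where instance _ = n !≢0

Cov : ∀ {m} → Permutation′ m → Permutation′ m → (n : ℕ) → ℚ
Cov π₁ π₂ n = E n (λ τ → X π₁ τ * X π₂ τ) ℚ.- (E n (X π₁) ℚ.* E n (X π₂))

-- [i,j]_m with 1-based i,j replaced by 0-based Fin indices (i-1 = toℕ i)
bracket : (m : ℕ) → Fin m → Fin m → ℕ
bracket m i j = ((toℕ i + toℕ j) C toℕ i)
              * (((m ∸ 1 ∸ toℕ i) + (m ∸ 1 ∸ toℕ j)) C (m ∸ 1 ∸ toℕ i))

Mat : ℕ → Set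
Mat m = Fin m → Fin m → ℕ

A : (m : ℕ) → Mat m
A m = bracket m

P : ∀ {m} → Permutation′ m → Mat m
P π i j = if toℕ (π ⟨$⟩ʳ i) ≡ᵇ toℕ j then 1 else 0

Pinv : ∀ {m} → Permutation′ m → Mat m
Pinv π = P (flip π)

_⊗_ : ∀ {m} → Mat m → Mat m → Mat m
_⊗_ {m} M N i k = sum (map (λ j → M i j * N j k) (allFin m))

Tr : ∀ {m} → Mat m → ℕ
Tr {m} M = sum (map (λ i → M i i) (allFin m))

bracketSum : ∀ {m} → Permutation′ m → Permutation′ m → ℕ
bracketSum {m} π₁ π₂ =
  sum (concatMap (λ i → map (λ j → bracket m i j * bracket m (π₁ ⟨$⟩ʳ i) (π₂ ⟨$⟩ʳ j)) (allFin m)) (allFin m))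

c : ∀ {m} → Permutation′ m → Permutation′ m → ℚ
c {m} π₁ π₂ =
  ((+ Tr (A m ⊗ (P π₁ ⊗ (A m ⊗ Pinv π₂)))) ℤ.- (+ (((2 * m ∸ 1) C (m ∸ 1)) ^ 2)))
    / ((2 * m ∸ 1) ! * (2 * m ∸ 1) !)
  where instance _ = (2 * m ∸ 1) !* (2 * m ∸ 1) !≢0

ℕ→ℚ : ℕ → ℚ
ℕ→ℚ k = (+ k) / 1

{-# OPTIONS --safe #-}
module Submission where

-- Write each occurrence of π at f as a pair of increasing maps (f , a), a listing its values: τ ∘ f = a ∘ π.
-- Then ∑ τ, X π₁ τ * X π₂ τ counts quadruples (f , g , a , b) together with the permutations extending the
-- prescriptions τ ∘ f = a ∘ π₁ and τ ∘ g = b ∘ π₂.  If f and g have disjoint images, so must a and b, and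
-- there are (n - 2m)! extensions; if f and g meet exactly at (i , j), then a and b meet exactly at
-- (π₁ i , π₂ j), and there are (n - 2m + 1)! extensions, the pairs (f , g) being counted by n C (2m - 1) times
-- bracket i j; the pairs meeting at least twice are O(n^(2m-2)) in number.  With the falling factorials
-- n P′ k this gives
--   Cov = (bracketSum * (n P′ (2m - 1))) / ((2m - 1)!)² - ((n P′ m)² - n P′ (2m)) / (m!)⁴ + O(n^(2m-2)),
-- and (n P′ m)² - n P′ (2m) has leading term m² n^(2m-1).

open import Defs
open import Data.Nat using (ℕ; zero; suc; _+_; _<_; _≤_; _*_; _∸_; _^_; _!; z≤n; s≤s; s≤s⁻¹; _<ᵇ_; _≡ᵇ_; NonZero; >-nonZero⁻¹)
open import Data.Nat.Properties hiding (_≟_; _<?_; _≤?_; suc-injective)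
open import Data.Nat.Combinatorics using (_C_; nCk+nC[k+1]≡[n+1]C[k+1]; nCn≡1; nCk≡n!/k![n-k]!; k![n∸k]!∣n!; nCk≡nC[n∸k])
open import Data.Nat.Combinatorics.Base using (_P′_)
open import Data.Nat.DivMod using (_/_; m/n*n≡m)
open import Data.Nat.Tactic.RingSolver using (solve-∀)
open import Algebra.Properties.Semiring.Sum +-*-semiring
  using (sum-syntax; sum-cong-≗; sum-replicate-zero; ∑-distrib-+; ∑-comm; *-distribˡ-sum; *-distribʳ-sum)
open import Data.Bool using (Bool; true; false; T; _∧_; _∨_; not; if_then_else_)
open import Data.Bool.ListAction using (and)
open import Data.Bool.Properties using (T-∧)
open import Data.Empty using (⊥-elim)
open import Data.Fin using (Fin; zero; suc; toℕ; punchIn; punchOut; splitAt; _↑ˡ_; _↑ʳ_)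
  renaming (_<_ to _<ᶠ_)
open import Data.Fin.Properties using (_≟_; _<?_; all?; any?; suc-injective; injective⇒≤; ¬∀⟶∃¬; toℕ-injective;
  punchIn-injective; punchInᵢ≢i; punchIn-punchOut; splitAt⁻¹-↑ˡ; splitAt⁻¹-↑ʳ)
open import Data.Fin.Permutation using (Permutation′; _⟨$⟩ʳ_; _⟨$⟩ˡ_; flip; inverseˡ; inverseʳ)
import Data.Integer as ℤ
import Data.Integer.Properties as ℤ
import Data.Integer.Tactic.RingSolver as ℤ-Ring
open import Data.List as List using (List; []; _∷_; map; concatMap; allFin; filterᵇ; length)
open import Data.List.Properties using (map-tabulate; map-++; map-id)
open import Data.Nat.ListAction using () renaming (sum to sumᴸ)
open import Data.Nat.ListAction.Properties using (sum-++)
open import Data.Product using (_×_; _,_; proj₁; proj₂; ∃-syntax)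
open import Data.Rational as ℚ using (ℚ)
import Data.Rational.Properties as ℚ
import Data.Rational.Solver as ℚ-Solver
import Data.Rational.Unnormalised as ℚᵘ
import Data.Rational.Unnormalised.Properties as ℚᵘ
open import Data.Sum using (_⊎_; inj₁; inj₂)
open import Data.Unit using (tt)
open import Data.Vec.Functional using (_++_)
open import Data.Vec.Functional.Properties using (lookup-++ˡ; lookup-++ʳ)
open import Function using (_∘_; id; _⇔_; mk⇔; Equivalence)
open import Function.Definitions using (Injective)
open import Relation.Binary.PropositionalEquality
  using (_≡_; _≢_; _≗_; refl; sym; trans; cong; cong₂; subst; subst₂; module ≡-Reasoning)
open import Relation.Binary using (tri<; tri≈; tri>)
open import Relation.Nullary using (¬_; Dec; yes; no; does; contradiction; _×-dec_; _→-dec_; ¬?)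
open import Relation.Nullary.Decidable using (map′)

-- Sums over functions and indicators

-- An injective `τ` preserves and reflects coincidences, so the number of `τ` meeting two
-- prescriptions depends only on how the positions meet and how the values meet; this is why
-- positions and values can be counted independently. The danger is the order n^(2m), which exceeds
-- the claim: disjoint pairs contribute `n P′ (m + m)` over (m!)^4, and the product of the two means
-- is the square of `n P′ m` over the same denominator. The excess has to cancel exactly and not
-- just to leading order, so the defect of multiplicativity is kept as the explicit sequence `gap`.
-- Its coefficient m² is the binomial square of `c` in disguise, because binom(2m-1, m-1) / (2m-1)!
-- = 1 / ((m-1)! m!) = m / (m!)². Counting identities stay in ℕ, with factorials or powers of n
-- multiplied through in place of division; rationals enter only at the end. Functions are compared
-- pointwise, so where one function is exchanged for a pointwise equal one the summand must satisfy
-- `Ext`.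

Ext : ∀ {m n} → ((Fin m → Fin n) → ℕ) → Set
Ext F = ∀ {f g} → f ≗ g → F f ≡ F g

-- The recursion is that of `allFuns`, so the list sums of the definitions convert to it directly.
∑ᶠ : ∀ m n → ((Fin m → Fin n) → ℕ) → ℕ
∑ᶠ zero    n F = F (λ ())
∑ᶠ (suc m) n F = ∑[ a < n ] ∑ᶠ m n (λ f → F (consF a f))

⟦_⟧ : Bool → ℕ
⟦ b ⟧ = if b then 1 else 0

𝟙 : ∀ {A : Set} → Dec A → ℕ
𝟙 A? = ⟦ does A? ⟧

module _ {A : Set} where

  𝟙-yes : (A? : Dec A) → A → 𝟙 A? ≡ 1
  𝟙-yes (yes _) _ = refl
  𝟙-yes (no ¬a) a = contradiction a ¬a

  𝟙-no : (A? : Dec A) → ¬ A → 𝟙 A? ≡ 0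
  𝟙-no (yes a) ¬a = contradiction a ¬a
  𝟙-no (no _)  _  = refl

  𝟙≤1 : (A? : Dec A) → 𝟙 A? ≤ 1
  𝟙≤1 (yes _) = s≤s z≤n
  𝟙≤1 (no _)  = z≤n

  𝟙-guard : ∀ (A? : Dec A) {x y} → (A → x ≡ y) → 𝟙 A? * x ≡ 𝟙 A? * y
  𝟙-guard (yes a) eq = cong (_+ 0) (eq a)
  𝟙-guard (no _)  eq = refl

  𝟙-*-≤ : (A? : Dec A) → ∀ x → 𝟙 A? * x ≤ x
  𝟙-*-≤ A? x = ≤-trans (*-monoˡ-≤ x (𝟙≤1 A?)) (≤-reflexive (*-identityˡ x))

  -- The bridge from the Boolean tests of the definitions to decidable propositions.
  ⟦⟧≡𝟙 : ∀ (b : Bool) (A? : Dec A) → (T b → A) → (A → T b) → ⟦ b ⟧ ≡ 𝟙 A?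
  ⟦⟧≡𝟙 true  (yes _) _ _ = refl
  ⟦⟧≡𝟙 true  (no ¬a) f _ = contradiction (f tt) ¬a
  ⟦⟧≡𝟙 false (yes a) _ g = ⊥-elim (g a)
  ⟦⟧≡𝟙 false (no _)  _ _ = refl

  module _ {B : Set} where

    𝟙-⇔ : (A? : Dec A) (B? : Dec B) → (A → B) → (B → A) → 𝟙 A? ≡ 𝟙 B?
    𝟙-⇔ A? (yes b) f g = 𝟙-yes A? (g b)
    𝟙-⇔ A? (no ¬b) f g = 𝟙-no A? (¬b ∘ f)

    𝟙-× : (A? : Dec A) (B? : Dec B) → 𝟙 (A? ×-dec B?) ≡ 𝟙 A? * 𝟙 B?
    𝟙-× (yes _) (yes _) = refl
    𝟙-× (yes _) (no _)  = refl
    𝟙-× (no _)  _       = refl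

∑-mono : ∀ {n} {F G : Fin n → ℕ} → (∀ i → F i ≤ G i) → ∑[ i < n ] F i ≤ ∑[ i < n ] G i
∑-mono {zero}  le = z≤n
∑-mono {suc n} le = +-mono-≤ (le zero) (∑-mono (le ∘ suc))

∑-const : ∀ n x → ∑[ i < n ] x ≡ n * x
∑-const zero    x = refl
∑-const (suc n) x = cong (x +_) (∑-const n x)

∑-zero : ∀ {n} {F : Fin n → ℕ} → (∀ i → F i ≡ 0) → ∑[ i < n ] F i ≡ 0
∑-zero {n} eq = trans (sum-cong-≗ eq) (sum-replicate-zero n)

∑-δ : ∀ {n} (i : Fin n) (F : Fin n → ℕ) → ∑[ j < n ] (𝟙 (j ≟ i) * F j) ≡ F i
∑-δ {suc n} zero F = begin
  F zero + 0 + ∑[ j < n ] 0  ≡⟨ cong (F zero + 0 +_) (sum-replicate-zero n) ⟩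
  F zero + 0 + 0             ≡⟨ trans (+-identityʳ _) (+-identityʳ _) ⟩
  F zero                     ∎
  where open ≡-Reasoning
∑-δ (suc i) F = ∑-δ i (F ∘ suc)

∑∑-* : ∀ {m n} (F : Fin m → ℕ) (G : Fin n → ℕ) →
       ∑[ i < m ] ∑[ j < n ] (F i * G j) ≡ ∑[ i < m ] F i * ∑[ j < n ] G j
∑∑-* F G = trans (sum-cong-≗ (λ i → sym (*-distribˡ-sum (F i) G))) (sym (*-distribʳ-sum (∑[ j < _ ] G j) F))

∑ᶠ-cong : ∀ m {n} {F G : (Fin m → Fin n) → ℕ} → (∀ f → F f ≡ G f) → ∑ᶠ m n F ≡ ∑ᶠ m n G
∑ᶠ-cong zero    eq = eq (λ ())
∑ᶠ-cong (suc m) eq = sum-cong-≗ (λ a → ∑ᶠ-cong m (λ f → eq (consF a f)))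

∑ᶠ-mono : ∀ m {n} {F G : (Fin m → Fin n) → ℕ} → (∀ f → F f ≤ G f) → ∑ᶠ m n F ≤ ∑ᶠ m n G
∑ᶠ-mono zero    le = le (λ ())
∑ᶠ-mono (suc m) le = ∑-mono (λ a → ∑ᶠ-mono m (λ f → le (consF a f)))

∑ᶠ-zero : ∀ m {n} {F : (Fin m → Fin n) → ℕ} → (∀ f → F f ≡ 0) → ∑ᶠ m n F ≡ 0
∑ᶠ-zero zero    eq = eq (λ ())
∑ᶠ-zero (suc m) eq = ∑-zero (λ a → ∑ᶠ-zero m (λ f → eq (consF a f)))

∑ᶠ-+ : ∀ m {n} F G → ∑ᶠ m n (λ f → F f + G f) ≡ ∑ᶠ m n F + ∑ᶠ m n G
∑ᶠ-+ zero    F G = refl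
∑ᶠ-+ (suc m) F G = trans (sum-cong-≗ (λ a → ∑ᶠ-+ m (F ∘ consF a) (G ∘ consF a))) (∑-distrib-+ (λ a → ∑ᶠ m _ (F ∘ consF a)) (λ a → ∑ᶠ m _ (G ∘ consF a)))

∑ᶠ-*ˡ : ∀ m {n} x F → ∑ᶠ m n (λ f → x * F f) ≡ x * ∑ᶠ m n F
∑ᶠ-*ˡ zero    x F = refl
∑ᶠ-*ˡ (suc m) x F = trans (sum-cong-≗ (λ a → ∑ᶠ-*ˡ m x (F ∘ consF a))) (sym (*-distribˡ-sum x (λ a → ∑ᶠ m _ (λ f → F (consF a f)))))

∑ᶠ-*ʳ : ∀ m {n} x F → ∑ᶠ m n (λ f → F f * x) ≡ ∑ᶠ m n F * x
∑ᶠ-*ʳ m x F = trans (∑ᶠ-cong m (λ f → *-comm (F f) x)) (trans (∑ᶠ-*ˡ m x F) (*-comm x _))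

∑ᶠ-∑-comm : ∀ m {n k} (F : (Fin m → Fin n) → Fin k → ℕ) →
            ∑ᶠ m n (λ f → ∑[ i < k ] F f i) ≡ ∑[ i < k ] ∑ᶠ m n (λ f → F f i)
∑ᶠ-∑-comm zero    F = refl
∑ᶠ-∑-comm (suc m) {n} F = trans (sum-cong-≗ (λ a → ∑ᶠ-∑-comm m (F ∘ consF a))) (∑-comm (λ a i → ∑ᶠ m n (λ f → F (consF a f) i)))

∑ᶠ-comm : ∀ m {n} k {l} (F : (Fin m → Fin n) → (Fin k → Fin l) → ℕ) →
          ∑ᶠ m n (λ f → ∑ᶠ k l (λ g → F f g)) ≡ ∑ᶠ k l (λ g → ∑ᶠ m n (λ f → F f g))
∑ᶠ-comm m zero    F = refl
∑ᶠ-comm m (suc k) F = trans (∑ᶠ-∑-comm m (λ f a → ∑ᶠ k _ (F f ∘ consF a)))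
  (sum-cong-≗ (λ a → ∑ᶠ-comm m k (λ f → F f ∘ consF a)))

consF-cong : ∀ {m n} (a : Fin n) {f g : Fin m → Fin n} → f ≗ g → consF a f ≗ consF a g
consF-cong a eq zero    = refl
consF-cong a eq (suc i) = eq i

consF-η : ∀ {m n} (f : Fin (suc m) → Fin n) → consF (f zero) (f ∘ suc) ≗ f
consF-η f zero    = refl
consF-η f (suc i) = refl

abstract

  _≗?_ : ∀ {m n} (f g : Fin m → Fin n) → Dec (f ≗ g)
  f ≗? g = all? (λ i → f i ≟ g i)

consF-≗? : ∀ {m n} a (f : Fin m → Fin n) g → 𝟙 (consF a f ≗? g) ≡ 𝟙 (a ≟ g zero) * 𝟙 (f ≗? (g ∘ suc))
consF-≗? a f g = trans
  (𝟙-⇔ (consF a f ≗? g) ((a ≟ g zero) ×-dec (f ≗? (g ∘ suc)))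
     (λ eq → eq zero , eq ∘ suc) (λ { (eq , eqs) zero → eq ; (eq , eqs) (suc i) → eqs i }))
  (𝟙-× (a ≟ g zero) (f ≗? (g ∘ suc)))

∑ᶠ-δ : ∀ m {n} (g : Fin m → Fin n) {F} → Ext F → ∑ᶠ m n (λ f → 𝟙 (f ≗? g) * F f) ≡ F g
∑ᶠ-δ zero    g {F} ext = begin
  𝟙 ((λ ()) ≗? g) * F (λ ())  ≡⟨ cong (_* F (λ ())) (𝟙-yes ((λ ()) ≗? g) (λ ())) ⟩
  1 * F (λ ())                ≡⟨ *-identityˡ _ ⟩
  F (λ ())                    ≡⟨ ext (λ ()) ⟩
  F g                         ∎
  where open ≡-Reasoning
∑ᶠ-δ (suc m) {n} g {F} ext = begin
  ∑[ a < n ] ∑ᶠ m n (λ f → 𝟙 (consF a f ≗? g) * F (consF a f))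
    ≡⟨ sum-cong-≗ (λ a → ∑ᶠ-cong m (λ f → trans (cong (_* F (consF a f)) (consF-≗? a f g)) (*-assoc (𝟙 (a ≟ g zero)) _ _))) ⟩
  ∑[ a < n ] ∑ᶠ m n (λ f → 𝟙 (a ≟ g zero) * (𝟙 (f ≗? (g ∘ suc)) * F (consF a f)))
    ≡⟨ sum-cong-≗ (λ a → ∑ᶠ-*ˡ m (𝟙 (a ≟ g zero)) _) ⟩
  ∑[ a < n ] (𝟙 (a ≟ g zero) * ∑ᶠ m n (λ f → 𝟙 (f ≗? (g ∘ suc)) * F (consF a f)))
    ≡⟨ ∑-δ (g zero) _ ⟩
  ∑ᶠ m n (λ f → 𝟙 (f ≗? (g ∘ suc)) * F (consF (g zero) f))
    ≡⟨ ∑ᶠ-δ m (g ∘ suc) (λ eq → ext (consF-cong (g zero) eq)) ⟩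
  -- The rebuilt function agrees with `g` only pointwise, so `ext` is needed for the last step.
  F (consF (g zero) (g ∘ suc))
    ≡⟨ ext (consF-η g) ⟩
  F g ∎
  where open ≡-Reasoning

-- From sums over lists to sums over functions

sum-allFin : ∀ n (F : Fin n → ℕ) → sumᴸ (map F (allFin n)) ≡ ∑[ i < n ] F i
sum-allFin n F = trans (cong sumᴸ (map-tabulate id F)) (go n F)
  where
  go : ∀ n (F : Fin n → ℕ) → sumᴸ (List.tabulate F) ≡ ∑[ i < n ] F i
  go zero    F = refl
  go (suc n) F = cong (F zero +_) (go n (F ∘ suc))

module _ {A B : Set} (F : B → ℕ) where

  sum-map-concatMap : ∀ (h : A → List B) xs →
                      sumᴸ (map F (concatMap h xs)) ≡ sumᴸ (map (λ x → sumᴸ (map F (h x))) xs)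
  sum-map-concatMap h []       = refl
  sum-map-concatMap h (x ∷ xs) = begin
    sumᴸ (map F (h x List.++ concatMap h xs))             ≡⟨ cong sumᴸ (map-++ F (h x) _) ⟩
    sumᴸ (map F (h x) List.++ map F (concatMap h xs))     ≡⟨ sum-++ (map F (h x)) _ ⟩
    sumᴸ (map F (h x)) + sumᴸ (map F (concatMap h xs))    ≡⟨ cong (_ +_) (sum-map-concatMap h xs) ⟩
    sumᴸ (map F (h x)) + sumᴸ (map (λ x → sumᴸ (map F (h x))) xs) ∎
    where open ≡-Reasoning

  sum-map-map : ∀ (h : A → B) xs → sumᴸ (map F (map h xs)) ≡ sumᴸ (map (F ∘ h) xs)
  sum-map-map h []       = refl
  sum-map-map h (x ∷ xs) = cong (_ +_) (sum-map-map h xs)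

module _ {A : Set} where

  sum-map-cong : ∀ {F G : A → ℕ} → F ≗ G → ∀ xs → sumᴸ (map F xs) ≡ sumᴸ (map G xs)
  sum-map-cong eq []       = refl
  sum-map-cong eq (x ∷ xs) = cong₂ _+_ (eq x) (sum-map-cong eq xs)

  sum-filterᵇ : ∀ (p : A → Bool) F xs → sumᴸ (map F (filterᵇ p xs)) ≡ sumᴸ (map (λ x → ⟦ p x ⟧ * F x) xs)
  sum-filterᵇ p F []       = refl
  sum-filterᵇ p F (x ∷ xs) with p x
  ... | true  = cong₂ _+_ (sym (+-identityʳ _)) (sum-filterᵇ p F xs)
  ... | false = sum-filterᵇ p F xs

  length-filterᵇ : ∀ (p : A → Bool) xs → length (filterᵇ p xs) ≡ sumᴸ (map (⟦_⟧ ∘ p) xs)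
  length-filterᵇ p []       = refl
  length-filterᵇ p (x ∷ xs) with p x
  ... | true  = cong suc (length-filterᵇ p xs)
  ... | false = length-filterᵇ p xs

sum-allFuns : ∀ m n F → sumᴸ (map F (allFuns m n)) ≡ ∑ᶠ m n F
sum-allFuns zero    n F = +-identityʳ _
sum-allFuns (suc m) n F = begin
  sumᴸ (map F (allFuns (suc m) n))
    ≡⟨ sum-map-concatMap F (λ a → map (consF a) (allFuns m n)) (allFin n) ⟩
  sumᴸ (map (λ a → sumᴸ (map F (map (consF a) (allFuns m n)))) (allFin n))
    ≡⟨ sum-map-cong (λ a → trans (sum-map-map F (consF a) (allFuns m n)) (sum-allFuns m n (F ∘ consF a))) (allFin n) ⟩
  sumᴸ (map (λ a → ∑ᶠ m n (λ f → F (consF a f))) (allFin n))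
    ≡⟨ sum-allFin n _ ⟩
  ∑ᶠ (suc m) n F ∎
  where open ≡-Reasoning

-- Increasing maps, permutations and occurrences

Increasing : ∀ {m n} → (Fin m → Fin n) → Set
Increasing f = ∀ i j → i <ᶠ j → f i <ᶠ f j

abstract

  increasing? : ∀ {m n} (f : Fin m → Fin n) → Dec (Increasing f)
  increasing? f = all? (λ i → all? (λ j → (i <? j) →-dec (f i <? f j)))

  injective? : ∀ {m n} (f : Fin m → Fin n) → Dec (Injective _≡_ _≡_ f)
  injective? f = map′ (λ inj {i} {j} → inj i j) (λ inj i j → inj)
    (all? (λ i → all? (λ j → (f i ≟ f j) →-dec (i ≟ j))))

increasing⇒injective : ∀ {m n} {f : Fin m → Fin n} → Increasing f → Injective _≡_ _≡_ f
increasing⇒injective {f = f} inc {i} {j} eq with <-cmp (toℕ i) (toℕ j)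
... | tri< i<j _ _ = contradiction (cong toℕ eq) (<⇒≢ (inc i j i<j))
... | tri≈ _ i≡j _ = toℕ-injective i≡j
... | tri> _ _ j<i = contradiction (cong toℕ (sym eq)) (<⇒≢ (inc j i j<i))

increasing-cong : ∀ {m n} {f g : Fin m → Fin n} → f ≗ g → Increasing f → Increasing g
increasing-cong f≗g inc i j i<j rewrite sym (f≗g i) | sym (f≗g j) = inc i j i<j

injective-cong : ∀ {m n} {f g : Fin m → Fin n} → f ≗ g → Injective _≡_ _≡_ f → Injective _≡_ _≡_ g
injective-cong f≗g inj {i} {j} eq = inj (trans (f≗g i) (trans eq (sym (f≗g j))))

increasing?-ext : ∀ {m n} → Ext {m} {n} (λ f → 𝟙 (increasing? f))
increasing?-ext {f = f} {g} f≗g = 𝟙-⇔ (increasing? f) (increasing? g) (increasing-cong f≗g) (increasing-cong (sym ∘ f≗g))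

injective?-ext : ∀ {m n} → Ext {m} {n} (λ f → 𝟙 (injective? f))
injective?-ext {f = f} {g} f≗g = 𝟙-⇔ (injective? f) (injective? g) (injective-cong f≗g) (injective-cong (sym ∘ f≗g))

-- Restriction is by an indicator weight instead of a filtered domain, so the laws of `∑ᶠ` apply
-- without change.
∑ᴵ : ∀ m n → ((Fin m → Fin n) → ℕ) → ℕ
∑ᴵ m n F = ∑ᶠ m n (λ f → 𝟙 (increasing? f) * F f)

∑ˢ : ∀ n → ((Fin n → Fin n) → ℕ) → ℕ
∑ˢ n F = ∑ᶠ n n (λ τ → 𝟙 (injective? τ) * F τ)

-- Boolean tests as indicators

and-++ : ∀ xs ys → and (xs List.++ ys) ≡ and xs ∧ and ys
and-++ []           ys = refl
and-++ (true ∷ xs)  ys = and-++ xs ys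
and-++ (false ∷ xs) ys = refl

T-and-tabulate : ∀ k (b : Fin k → Bool) → T (and (List.tabulate b)) ⇔ (∀ i → T (b i))
T-and-tabulate zero    b = mk⇔ (λ _ ()) (λ _ → tt)
T-and-tabulate (suc k) b = mk⇔
  (λ t → λ { zero → proj₁ (Equivalence.to T-∧ t) ; (suc i) → Equivalence.to (T-and-tabulate k (b ∘ suc)) (proj₂ (Equivalence.to T-∧ t)) i })
  (λ t → Equivalence.from T-∧ (t zero , Equivalence.from (T-and-tabulate k (b ∘ suc)) (t ∘ suc)))

T-allPairs : ∀ k p → T (allPairs k p) ⇔ (∀ i j → T (p i j))
T-allPairs k p = subst (λ b → T b ⇔ (∀ i j → T (p i j))) (sym eq)
  (mk⇔ (λ t i → Equivalence.to (T-and-tabulate k (p i)) (Equivalence.to (T-and-tabulate k _) t i))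
       (λ t → Equivalence.from (T-and-tabulate k _) (λ i → Equivalence.from (T-and-tabulate k (p i)) (t i))))
  where
  and-concatMap : ∀ {A : Set} (h : A → List Bool) xs → and (concatMap h xs) ≡ and (map (and ∘ h) xs)
  and-concatMap h []       = refl
  and-concatMap h (x ∷ xs) = trans (and-++ (h x) _) (cong (and (h x) ∧_) (and-concatMap h xs))

  tabulate-cong : ∀ {n} {b b′ : Fin n → Bool} → b ≗ b′ → List.tabulate b ≡ List.tabulate b′
  tabulate-cong {zero}  eq = refl
  tabulate-cong {suc n} eq = cong₂ _∷_ (eq zero) (tabulate-cong (eq ∘ suc))

  eq : allPairs k p ≡ and (List.tabulate (λ i → and (List.tabulate (p i))))
  eq = trans (and-concatMap (λ i → map (p i) (allFin k)) (allFin k))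
    (cong and (trans (map-tabulate id _) (tabulate-cong (λ i → cong and (map-tabulate id (p i))))))

T-⇒ : ∀ x y → T (not x ∨ y) ⇔ (T x → T y)
T-⇒ true  y = mk⇔ (λ y _ → y) (λ f → f tt)
T-⇒ false y = mk⇔ (λ _ ()) (λ _ → tt)

T-==ᵇ : ∀ x y → T (x ==ᵇ y) ⇔ ((T x → T y) × (T y → T x))
T-==ᵇ true  true  = mk⇔ (λ _ → id , id) (λ _ → tt)
T-==ᵇ true  false = mk⇔ (λ ()) (λ (f , _) → f tt)
T-==ᵇ false true  = mk⇔ (λ ()) (λ (_ , g) → g tt)
T-==ᵇ false false = mk⇔ (λ _ → id , id) (λ _ → tt)

⟦increasingᵇ⟧ : ∀ {m n} (f : Fin m → Fin n) → ⟦ increasingᵇ f ⟧ ≡ 𝟙 (increasing? f)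
⟦increasingᵇ⟧ {m} f = ⟦⟧≡𝟙 (increasingᵇ f) (increasing? f)
  (λ t i j i<j → <ᵇ⇒< _ _ (Equivalence.to (T-⇒ (toℕ i <ᵇ toℕ j) _) (Equivalence.to (T-allPairs m _) t i j) (<⇒<ᵇ i<j)))
  (λ inc → Equivalence.from (T-allPairs m _) (λ i j → Equivalence.from (T-⇒ (toℕ i <ᵇ toℕ j) _)
    (λ t → <⇒<ᵇ (inc i j (<ᵇ⇒< _ _ t)))))

⟦injectiveᵇ⟧ : ∀ {n} (τ : Fin n → Fin n) → ⟦ injectiveᵇ τ ⟧ ≡ 𝟙 (injective? τ)
⟦injectiveᵇ⟧ {n} τ = ⟦⟧≡𝟙 (injectiveᵇ τ) (injective? τ)
  (λ t {i} {j} eq → toℕ-injective (≡ᵇ⇒≡ _ _ (Equivalence.to (T-⇒ (toℕ (τ i) ≡ᵇ toℕ (τ j)) _)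
    (Equivalence.to (T-allPairs n _) t i j) (≡⇒≡ᵇ _ _ (cong toℕ eq)))))
  (λ inj → Equivalence.from (T-allPairs n _) (λ i j → Equivalence.from (T-⇒ (toℕ (τ i) ≡ᵇ toℕ (τ j)) _)
    (λ t → ≡⇒≡ᵇ _ _ (cong toℕ (inj (toℕ-injective (≡ᵇ⇒≡ _ _ t)))))))

-- Reading the entries at `f` in the order of their ranks under `π`, that is along `π ⟨$⟩ˡ_`, turns
-- order-isomorphism with `π` into monotonicity. Monotonicity gives one direction of each comparison
-- directly; the converse follows by trichotomy.
⟦isOccurrenceᵇ⟧ : ∀ {m n} (π : Permutation′ m) (τ : Fin n → Fin n) (f : Fin m → Fin n) →
  ⟦ isOccurrenceᵇ π τ f ⟧ ≡ 𝟙 (increasing? (τ ∘ f ∘ (π ⟨$⟩ˡ_)))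
⟦isOccurrenceᵇ⟧ {m} π τ f = ⟦⟧≡𝟙 (isOccurrenceᵇ π τ f) (increasing? (τ ∘ f ∘ (π ⟨$⟩ˡ_))) to from
  where
  to : T (isOccurrenceᵇ π τ f) → Increasing (τ ∘ f ∘ (π ⟨$⟩ˡ_))
  to t i j i<j = <ᵇ⇒< _ _ (proj₂ (Equivalence.to (T-==ᵇ (toℕ (τ (f i′)) <ᵇ toℕ (τ (f j′))) _)
      (Equivalence.to (T-allPairs m _) t i′ j′))
      (subst T (sym (cong₂ (λ x y → toℕ x <ᵇ toℕ y) (inverseʳ π) (inverseʳ π))) (<⇒<ᵇ i<j)))
    where
    i′ j′ : Fin m
    i′ = π ⟨$⟩ˡ i
    j′ = π ⟨$⟩ˡ j

  module _ (inc : Increasing (τ ∘ f ∘ (π ⟨$⟩ˡ_))) where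

    inc′ : ∀ a b → (π ⟨$⟩ʳ a) <ᶠ (π ⟨$⟩ʳ b) → τ (f a) <ᶠ τ (f b)
    inc′ a b lt = subst (λ x → τ (f x) <ᶠ τ (f b)) (inverseˡ π)
      (subst (λ x → τ (f (π ⟨$⟩ˡ (π ⟨$⟩ʳ a))) <ᶠ τ (f x)) (inverseˡ π) (inc _ _ lt))

    inc″ : ∀ a b → τ (f a) <ᶠ τ (f b) → (π ⟨$⟩ʳ a) <ᶠ (π ⟨$⟩ʳ b)
    inc″ a b lt with <-cmp (toℕ (π ⟨$⟩ʳ a)) (toℕ (π ⟨$⟩ʳ b))
    ... | tri< πa<πb _ _ = πa<πb
    ... | tri≈ _ πa≡πb _ = contradiction (cong (toℕ ∘ τ ∘ f)
            (trans (sym (inverseˡ π)) (trans (cong (π ⟨$⟩ˡ_) (toℕ-injective πa≡πb)) (inverseˡ π)))) (<⇒≢ lt)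
    ... | tri> _ _ πb<πa = contradiction (inc′ b a πb<πa) (<-asym lt)

  from : Increasing (τ ∘ f ∘ (π ⟨$⟩ˡ_)) → T (isOccurrenceᵇ π τ f)
  from inc = Equivalence.from (T-allPairs m _) (λ a b → Equivalence.from (T-==ᵇ (toℕ (τ (f a)) <ᵇ toℕ (τ (f b))) _)
    ( (λ t → <⇒<ᵇ (inc″ inc a b (<ᵇ⇒< _ _ t)))
    , (λ t → <⇒<ᵇ (inc′ inc a b (<ᵇ⇒< _ _ t)))))

sum-Sym : ∀ n F → sumᴸ (map F (Sym n)) ≡ ∑ˢ n F
sum-Sym n F = trans (sum-filterᵇ injectiveᵇ F (allFuns n n)) (trans (sum-allFuns n n _)
  (∑ᶠ-cong n (λ τ → cong (_* F τ) (⟦injectiveᵇ⟧ τ))))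

X≡∑ : ∀ {m n} (π : Permutation′ m) (τ : Fin n → Fin n) →
      X π τ ≡ ∑ᴵ m n (λ f → 𝟙 (increasing? (τ ∘ f ∘ (π ⟨$⟩ˡ_))))
X≡∑ {m} {n} π τ = begin
  X π τ
    ≡⟨ length-filterᵇ (isOccurrenceᵇ π τ) (positionSets m n) ⟩
  sumᴸ (map (⟦_⟧ ∘ isOccurrenceᵇ π τ) (positionSets m n))
    ≡⟨ sum-filterᵇ increasingᵇ _ (allFuns m n) ⟩
  sumᴸ (map (λ f → ⟦ increasingᵇ f ⟧ * ⟦ isOccurrenceᵇ π τ f ⟧) (allFuns m n))
    ≡⟨ sum-allFuns m n _ ⟩
  ∑ᶠ m n (λ f → ⟦ increasingᵇ f ⟧ * ⟦ isOccurrenceᵇ π τ f ⟧)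
    ≡⟨ ∑ᶠ-cong m (λ f → cong₂ _*_ (⟦increasingᵇ⟧ f) (⟦isOccurrenceᵇ⟧ π τ f)) ⟩
  ∑ᴵ m n (λ f → 𝟙 (increasing? (τ ∘ f ∘ (π ⟨$⟩ˡ_)))) ∎
  where open ≡-Reasoning

-- An increasing a with τ ∘ f ≗ a ∘ π lists the values taken by the occurrence of π at f.
𝟙-occurrence : ∀ {m n} (π : Permutation′ m) (τ : Fin n → Fin n) (f : Fin m → Fin n) →
  𝟙 (increasing? (τ ∘ f ∘ (π ⟨$⟩ˡ_))) ≡ ∑ᴵ m n (λ a → 𝟙 ((τ ∘ f) ≗? (a ∘ (π ⟨$⟩ʳ_))))
𝟙-occurrence {m} {n} π τ f = sym (begin
  ∑ᶠ m n (λ a → 𝟙 (increasing? a) * 𝟙 ((τ ∘ f) ≗? (a ∘ (π ⟨$⟩ʳ_))))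
    ≡⟨ ∑ᶠ-cong m (λ a → trans (*-comm (𝟙 (increasing? a)) _) (cong (_* 𝟙 (increasing? a))
         (𝟙-⇔ ((τ ∘ f) ≗? (a ∘ (π ⟨$⟩ʳ_))) (a ≗? (τ ∘ f ∘ (π ⟨$⟩ˡ_)))
           (λ eq i → trans (cong a (sym (inverseʳ π))) (sym (eq _)))
           (λ eq i → trans (cong (τ ∘ f) (sym (inverseˡ π))) (sym (eq _)))))) ⟩
  ∑ᶠ m n (λ a → 𝟙 (a ≗? (τ ∘ f ∘ (π ⟨$⟩ˡ_))) * 𝟙 (increasing? a))
    ≡⟨ ∑ᶠ-δ m (τ ∘ f ∘ (π ⟨$⟩ˡ_)) increasing?-ext ⟩
  𝟙 (increasing? (τ ∘ f ∘ (π ⟨$⟩ˡ_))) ∎)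
  where open ≡-Reasoning

-- Permutations with prescribed values

_∈_ : ∀ {k n} → Fin n → (Fin k → Fin n) → Set
y ∈ h = ∃[ i ] h i ≡ y

_∈?_ : ∀ {k n} (y : Fin n) (h : Fin k → Fin n) → Dec (y ∈ h)
y ∈? h = any? (λ i → h i ≟ y)

module _ {k n : ℕ} {h : Fin k → Fin n} (h-inj : Injective _≡_ _≡_ h) where

  consF-injective : ∀ {y} → ¬ (y ∈ h) → Injective _≡_ _≡_ (consF y h)
  consF-injective y∉h {zero}  {zero}  eq = refl
  consF-injective y∉h {zero}  {suc j} eq = contradiction (j , sym eq) y∉h
  consF-injective y∉h {suc i} {zero}  eq = contradiction (i , eq) y∉h
  consF-injective y∉h {suc i} {suc j} eq = cong suc (h-inj eq)

  -- Pigeonhole: a missed value could be prepended to `h`, giving an injection from a set larger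
  -- than its target.
  injective⇒surjective : n ≤ k → ∀ y → y ∈ h
  injective⇒surjective n≤k y with y ∈? h
  ... | yes y∈h = y∈h
  ... | no  y∉h = contradiction (injective⇒≤ (consF-injective y∉h)) (<⇒≱ (s≤s n≤k))

  -- Double counting of the pairs `h i ≡ x`: injectivity makes every fibre a point or empty.
  ∑-𝟙-∈ : ∑[ x < n ] 𝟙 (x ∈? h) ≡ k
  ∑-𝟙-∈ = begin
    ∑[ x < n ] 𝟙 (x ∈? h)              ≡⟨ sum-cong-≗ fibre ⟩
    ∑[ x < n ] ∑[ i < k ] 𝟙 (h i ≟ x)  ≡⟨ ∑-comm (λ x i → 𝟙 (h i ≟ x)) ⟩
    ∑[ i < k ] ∑[ x < n ] 𝟙 (h i ≟ x)  ≡⟨ sum-cong-≗ (λ i → sum-cong-≗ (λ x → trans (𝟙-⇔ (h i ≟ x) (x ≟ h i) sym sym) (sym (*-identityʳ _)))) ⟩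
    ∑[ i < k ] ∑[ x < n ] (𝟙 (x ≟ h i) * 1)  ≡⟨ sum-cong-≗ (λ i → ∑-δ (h i) (λ _ → 1)) ⟩
    ∑[ i < k ] 1                       ≡⟨ trans (∑-const k 1) (*-identityʳ k) ⟩
    k                                  ∎
    where
    open ≡-Reasoning
    fibre : ∀ x → 𝟙 (x ∈? h) ≡ ∑[ i < k ] 𝟙 (h i ≟ x)
    fibre x with x ∈? h
    ... | yes (i₀ , refl) = sym (trans
            (sum-cong-≗ (λ i → trans (𝟙-⇔ (h i ≟ h i₀) (i ≟ i₀) h-inj (cong h)) (sym (*-identityʳ _))))
            (∑-δ i₀ (λ _ → 1)))
    ... | no x∉h = sym (∑-zero (λ i → 𝟙-no (h i ≟ x) (λ eq → x∉h (i , eq))))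

  ∑-𝟙-∉ : ∀ {d} → k + d ≡ n → ∑[ x < n ] 𝟙 (¬? (x ∈? h)) ≡ d
  ∑-𝟙-∉ {d} k+d≡n = +-cancelˡ-≡ k _ _ (begin
    k + ∑[ x < n ] 𝟙 (¬? (x ∈? h))
      ≡⟨ cong (_+ ∑[ x < n ] 𝟙 (¬? (x ∈? h))) (sym ∑-𝟙-∈) ⟩
    ∑[ x < n ] 𝟙 (x ∈? h) + ∑[ x < n ] 𝟙 (¬? (x ∈? h))
      ≡⟨ sym (∑-distrib-+ (λ x → 𝟙 (x ∈? h)) (λ x → 𝟙 (¬? (x ∈? h)))) ⟩
    ∑[ x < n ] (𝟙 (x ∈? h) + 𝟙 (¬? (x ∈? h)))
      ≡⟨ sum-cong-≗ (λ x → excluded (x ∈? h)) ⟩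
    ∑[ x < n ] 1
      ≡⟨ trans (∑-const n 1) (trans (*-identityʳ n) (sym k+d≡n)) ⟩
    k + d ∎)
    where
    open ≡-Reasoning
    excluded : ∀ {A : Set} (A? : Dec A) → 𝟙 A? + 𝟙 (¬? A?) ≡ 1
    excluded (yes _) = refl
    excluded (no _)  = refl

injective⇒∃∉ : ∀ {k n} (h : Fin k → Fin n) → k < n → ∃[ y ] ¬ (y ∈ h)
injective⇒∃∉ {k} {n} h k<n = ¬∀⟶∃¬ n (_∈ h) (_∈? h) λ all∈ →
  contradiction (injective⇒≤ {f = proj₁ ∘ all∈} (λ {x} {y} eq → trans (sym (proj₂ (all∈ x))) (trans (cong h eq) (proj₂ (all∈ y))))) (<⇒≱ k<n)

-- Induction on the number `d` of positions left free. With none left, `h` is a bijection and `τ` is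
-- forced to be `w ∘ h⁻¹`. Otherwise pick a position `y` outside `h` and split by the value `x` of
-- `τ` there: the `suc d` values outside `w` each leave a problem with `d` free positions, and the
-- others admit no injective `τ`.
∑ˢ-fix : ∀ d {k n} → k + d ≡ n → {h w : Fin k → Fin n} → Injective _≡_ _≡_ h → Injective _≡_ _≡_ w →
         ∑ˢ n (λ τ → 𝟙 ((τ ∘ h) ≗? w)) ≡ d !
∑ˢ-fix zero {k} {n} k+0≡n {h} {w} h-inj w-inj = begin
  ∑ᶠ n n (λ τ → 𝟙 (injective? τ) * 𝟙 ((τ ∘ h) ≗? w))
    ≡⟨ ∑ᶠ-cong n (λ τ → trans (*-comm (𝟙 (injective? τ)) _) (cong (_* 𝟙 (injective? τ))
         (𝟙-⇔ ((τ ∘ h) ≗? w) (τ ≗? (w ∘ h⁻¹))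
           (λ eq y → trans (cong τ (sym (h∘h⁻¹ y))) (eq (h⁻¹ y)))
           (λ eq i → trans (eq (h i)) (cong w (h-inj (h∘h⁻¹ (h i)))))))) ⟩
  ∑ᶠ n n (λ τ → 𝟙 (τ ≗? (w ∘ h⁻¹)) * 𝟙 (injective? τ))
    ≡⟨ ∑ᶠ-δ n (w ∘ h⁻¹) injective?-ext ⟩
  𝟙 (injective? (w ∘ h⁻¹))
    ≡⟨ 𝟙-yes (injective? (w ∘ h⁻¹)) (λ {x} {y} eq → trans (sym (h∘h⁻¹ x)) (trans (cong h (w-inj eq)) (h∘h⁻¹ y))) ⟩
  1 ∎
  where
  open ≡-Reasoning
  surj : ∀ y → y ∈ h
  surj = injective⇒surjective h-inj (≤-reflexive (trans (sym k+0≡n) (+-identityʳ k)))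
  h⁻¹ : Fin n → Fin k
  h⁻¹ = proj₁ ∘ surj
  h∘h⁻¹ : ∀ y → h (h⁻¹ y) ≡ y
  h∘h⁻¹ = proj₂ ∘ surj
∑ˢ-fix (suc d) {k} {n} k+d≡n {h} {w} h-inj w-inj = begin
  ∑ᶠ n n (λ τ → 𝟙 (injective? τ) * 𝟙 ((τ ∘ h) ≗? w))
    -- A factor one is written as the sum over `x` of the indicator of `x ≡ τ y`.
    ≡⟨ ∑ᶠ-cong n (λ τ → cong (𝟙 (injective? τ) *_) (sym (∑-δ (τ y) (λ _ → 𝟙 ((τ ∘ h) ≗? w))))) ⟩
  ∑ᶠ n n (λ τ → 𝟙 (injective? τ) * ∑[ x < n ] (𝟙 (x ≟ τ y) * 𝟙 ((τ ∘ h) ≗? w)))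
    ≡⟨ ∑ᶠ-cong n (λ τ → *-distribˡ-sum (𝟙 (injective? τ)) (λ x → 𝟙 (x ≟ τ y) * 𝟙 ((τ ∘ h) ≗? w))) ⟩
  ∑ᶠ n n (λ τ → ∑[ x < n ] (𝟙 (injective? τ) * (𝟙 (x ≟ τ y) * 𝟙 ((τ ∘ h) ≗? w))))
    ≡⟨ ∑ᶠ-∑-comm n (λ τ x → 𝟙 (injective? τ) * (𝟙 (x ≟ τ y) * 𝟙 ((τ ∘ h) ≗? w))) ⟩
  ∑[ x < n ] ∑ᶠ n n (λ τ → 𝟙 (injective? τ) * (𝟙 (x ≟ τ y) * 𝟙 ((τ ∘ h) ≗? w)))
    ≡⟨ sum-cong-≗ (λ x → ∑ᶠ-cong n (λ τ → cong (𝟙 (injective? τ) *_) (merge x τ))) ⟩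
  ∑[ x < n ] ∑ˢ n (λ τ → 𝟙 ((τ ∘ consF y h) ≗? consF x w))
    ≡⟨ sum-cong-≗ extend ⟩
  ∑[ x < n ] (𝟙 (¬? (x ∈? w)) * d !)
    ≡⟨ sym (*-distribʳ-sum (d !) (λ x → 𝟙 (¬? (x ∈? w)))) ⟩
  ∑[ x < n ] 𝟙 (¬? (x ∈? w)) * d !
    ≡⟨ cong (_* d !) (∑-𝟙-∉ w-inj k+d≡n) ⟩
  suc d ! ∎
  where
  open ≡-Reasoning
  outside : ∃[ y ] ¬ (y ∈ h)
  outside = injective⇒∃∉ h (≤-trans (s≤s (m≤m+n k d)) (≤-reflexive (trans (sym (+-suc k d)) k+d≡n)))
  y : Fin n
  y = proj₁ outside
  y∉h : ¬ (y ∈ h)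
  y∉h = proj₂ outside
  merge : ∀ x τ → 𝟙 (x ≟ τ y) * 𝟙 ((τ ∘ h) ≗? w) ≡ 𝟙 ((τ ∘ consF y h) ≗? consF x w)
  merge x τ = trans (sym (𝟙-× (x ≟ τ y) ((τ ∘ h) ≗? w)))
    (𝟙-⇔ ((x ≟ τ y) ×-dec ((τ ∘ h) ≗? w)) ((τ ∘ consF y h) ≗? consF x w)
      (λ { (eq , eqs) zero → sym eq ; (eq , eqs) (suc i) → eqs i })
      (λ eqs → sym (eqs zero) , eqs ∘ suc))
  extend : ∀ x → ∑ˢ n (λ τ → 𝟙 ((τ ∘ consF y h) ≗? consF x w)) ≡ 𝟙 (¬? (x ∈? w)) * d !
  extend x with x ∈? w
  -- The value `x` is already taken at `h i`, so injectivity of `τ` would put `y` into the image of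
  -- `h`.
  ... | yes (i , wi≡x) = ∑ᶠ-zero n (λ τ → trans (𝟙-guard (injective? τ)
          (λ τ-inj → 𝟙-no ((τ ∘ consF y h) ≗? consF x w)
            (λ eqs → y∉h (i , τ-inj (trans (eqs (suc i)) (trans wi≡x (sym (eqs zero)))))))) (*-zeroʳ (𝟙 (injective? τ))))
  ... | no x∉w = trans (∑ˢ-fix d (trans (sym (+-suc k d)) k+d≡n) (consF-injective h-inj y∉h) (consF-injective w-inj x∉w))
                   (sym (+-identityʳ _))

-- Pairs of maps by the coincidences of their images

Disjoint : ∀ {p q n} → (Fin p → Fin n) → (Fin q → Fin n) → Set
Disjoint f g = ∀ i j → f i ≢ g j

MeetAt : ∀ {p q n} → Fin p → Fin q → (Fin p → Fin n) → (Fin q → Fin n) → Set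
MeetAt i j f g = f i ≡ g j × (∀ i′ j′ → f i′ ≡ g j′ → i′ ≡ i × j′ ≡ j)

abstract

  disjoint? : ∀ {p q n} (f : Fin p → Fin n) (g : Fin q → Fin n) → Dec (Disjoint f g)
  disjoint? f g = all? (λ i → all? (λ j → ¬? (f i ≟ g j)))

  meetAt? : ∀ {p q n} i j (f : Fin p → Fin n) (g : Fin q → Fin n) → Dec (MeetAt i j f g)
  meetAt? i j f g = (f i ≟ g j) ×-dec
    all? (λ i′ → all? (λ j′ → (f i′ ≟ g j′) →-dec ((i′ ≟ i) ×-dec (j′ ≟ j))))

↑-view : ∀ p {q} (i : Fin (p + q)) → (∃[ a ] a ↑ˡ q ≡ i) ⊎ (∃[ b ] p ↑ʳ b ≡ i)
↑-view p i with splitAt p i in eq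
... | inj₁ a = inj₁ (a , splitAt⁻¹-↑ˡ eq)
... | inj₂ b = inj₂ (b , splitAt⁻¹-↑ʳ eq)

++-injective : ∀ {p q n} {f : Fin p → Fin n} {g : Fin q → Fin n} →
  Injective _≡_ _≡_ f → Injective _≡_ _≡_ g → Disjoint f g → Injective _≡_ _≡_ (f ++ g)
++-injective {p} {q} {n} {f} {g} f-inj g-inj f#g {x} {y} eq with ↑-view p {q} x | ↑-view p {q} y
... | inj₁ (a , refl) | inj₁ (b , refl) = cong (_↑ˡ q) (f-inj (trans (sym (lookup-++ˡ f g a)) (trans eq (lookup-++ˡ f g b))))
... | inj₁ (a , refl) | inj₂ (b , refl) = contradiction (trans (sym (lookup-++ˡ f g a)) (trans eq (lookup-++ʳ f g b))) (f#g a b)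
... | inj₂ (a , refl) | inj₁ (b , refl) = contradiction (trans (sym (lookup-++ˡ f g b)) (trans (sym eq) (lookup-++ʳ f g a))) (f#g b a)
... | inj₂ (a , refl) | inj₂ (b , refl) = cong (p ↑ʳ_) (g-inj (trans (sym (lookup-++ʳ f g a)) (trans eq (lookup-++ʳ f g b))))

module _ {p q n : ℕ} {f u : Fin p → Fin n} {g v : Fin q → Fin n}
         (f-inj : Injective _≡_ _≡_ f) (g-inj : Injective _≡_ _≡_ g)
         (u-inj : Injective _≡_ _≡_ u) (v-inj : Injective _≡_ _≡_ v) where

  ++-≗? : ∀ (τ : Fin n → Fin n) → 𝟙 ((τ ∘ f) ≗? u) * 𝟙 ((τ ∘ g) ≗? v) ≡ 𝟙 ((τ ∘ (f ++ g)) ≗? (u ++ v))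
  ++-≗? τ = trans (sym (𝟙-× ((τ ∘ f) ≗? u) ((τ ∘ g) ≗? v)))
    (𝟙-⇔ (((τ ∘ f) ≗? u) ×-dec ((τ ∘ g) ≗? v)) ((τ ∘ (f ++ g)) ≗? (u ++ v)) to from)
    where
    to : (τ ∘ f) ≗ u × (τ ∘ g) ≗ v → (τ ∘ (f ++ g)) ≗ (u ++ v)
    to (eqf , eqg) x with ↑-view p {q} x
    ... | inj₁ (a , refl) = trans (cong τ (lookup-++ˡ f g a)) (trans (eqf a) (sym (lookup-++ˡ u v a)))
    ... | inj₂ (b , refl) = trans (cong τ (lookup-++ʳ f g b)) (trans (eqg b) (sym (lookup-++ʳ u v b)))
    from : (τ ∘ (f ++ g)) ≗ (u ++ v) → (τ ∘ f) ≗ u × (τ ∘ g) ≗ v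
    from eq = (λ a → trans (cong τ (sym (lookup-++ˡ f g a))) (trans (eq (a ↑ˡ q)) (lookup-++ˡ u v a)))
            , (λ b → trans (cong τ (sym (lookup-++ʳ f g b))) (trans (eq (p ↑ʳ b)) (lookup-++ʳ u v b)))

  -- An injective `τ` reflects coincidences, so values that meet cannot be prescribed on disjoint
  -- positions and the count is zero. If the values are disjoint too, both prescriptions combine
  -- into a single injective one on `f ++ g`.
  ∑ˢ-fix-disjoint : ∀ d → p + q + d ≡ n → Disjoint f g →
    ∑ˢ n (λ τ → 𝟙 ((τ ∘ f) ≗? u) * 𝟙 ((τ ∘ g) ≗? v)) ≡ 𝟙 (disjoint? u v) * d !
  ∑ˢ-fix-disjoint d p+q+d≡n f#g with disjoint? u v
  ... | yes u#v = trans (∑ᶠ-cong n (λ τ → cong (𝟙 (injective? τ) *_) (++-≗? τ)))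
          (trans (∑ˢ-fix d p+q+d≡n (++-injective f-inj g-inj f#g) (++-injective u-inj v-inj u#v)) (sym (+-identityʳ _)))
  ... | no ¬u#v = ∑ᶠ-zero n (λ τ → trans (𝟙-guard (injective? τ) (λ τ-inj →
          trans (sym (𝟙-× ((τ ∘ f) ≗? u) ((τ ∘ g) ≗? v)))
            (𝟙-no (((τ ∘ f) ≗? u) ×-dec ((τ ∘ g) ≗? v))
              (λ (eqf , eqg) → ¬u#v (λ i j ui≡vj → f#g i j (τ-inj (trans (eqf i) (trans ui≡vj (sym (eqg j)))))))))
          ) (*-zeroʳ (𝟙 (injective? τ))))

punchIn-disjoint : ∀ {p q n} {i j} {f : Fin p → Fin n} {g : Fin (suc q) → Fin n} →
                   MeetAt i j f g → Disjoint f (g ∘ punchIn j)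
punchIn-disjoint {j = j} (_ , only) i′ j′ eq = punchInᵢ≢i j j′ (proj₂ (only i′ (punchIn j j′) eq))

module _ {p q n : ℕ} {f u : Fin p → Fin n} {g v : Fin (suc q) → Fin n}
         (f-inj : Injective _≡_ _≡_ f) (g-inj : Injective _≡_ _≡_ g)
         (u-inj : Injective _≡_ _≡_ u) (v-inj : Injective _≡_ _≡_ v) where

  -- When positions and values meet at the same indices, the prescription at `j` repeats the one at
  -- `i`. Deleting `j` with `punchIn` leaves disjoint prescriptions on `p + q` positions. In all
  -- other cases the coincidence patterns differ, which no injective `τ` allows.
  ∑ˢ-fix-meetAt : ∀ d → p + q + d ≡ n → ∀ {i j} → MeetAt i j f g →
    ∑ˢ n (λ τ → 𝟙 ((τ ∘ f) ≗? u) * 𝟙 ((τ ∘ g) ≗? v)) ≡ 𝟙 (meetAt? i j u v) * d !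
  ∑ˢ-fix-meetAt d p+q+d≡n {i} {j} fg with meetAt? i j u v
  ... | yes uv = begin
    ∑ˢ n (λ τ → 𝟙 ((τ ∘ f) ≗? u) * 𝟙 ((τ ∘ g) ≗? v))
      ≡⟨ ∑ᶠ-cong n (λ τ → cong (𝟙 (injective? τ) *_) (𝟙-guard ((τ ∘ f) ≗? u) (λ eqf →
           𝟙-⇔ ((τ ∘ g) ≗? v) ((τ ∘ g ∘ punchIn j) ≗? (v ∘ punchIn j)) (_∘ punchIn j) (fill τ eqf)))) ⟩
    ∑ˢ n (λ τ → 𝟙 ((τ ∘ f) ≗? u) * 𝟙 ((τ ∘ g ∘ punchIn j) ≗? (v ∘ punchIn j)))
      ≡⟨ ∑ˢ-fix-disjoint f-inj (punchIn-injective j _ _ ∘ g-inj) u-inj (punchIn-injective j _ _ ∘ v-inj)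
           d p+q+d≡n (punchIn-disjoint fg) ⟩
    𝟙 (disjoint? u (v ∘ punchIn j)) * d !
      ≡⟨ cong (_* d !) (𝟙-yes (disjoint? u (v ∘ punchIn j)) (punchIn-disjoint uv)) ⟩
    1 * d ! ∎
    where
    open ≡-Reasoning
    -- The deleted prescription is recovered at `j` through the common position `f i ≡ g j` and the
    -- common value `u i ≡ v j`.
    fill : ∀ τ → (τ ∘ f) ≗ u → (τ ∘ g ∘ punchIn j) ≗ (v ∘ punchIn j) → (τ ∘ g) ≗ v
    fill τ eqf eqg x with j ≟ x
    ... | yes refl = trans (cong τ (sym (proj₁ fg))) (trans (eqf i) (proj₁ uv))
    ... | no  j≢x  = subst (λ y → τ (g y) ≡ v y) (punchIn-punchOut j≢x) (eqg (punchOut j≢x))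
  ... | no ¬uv = ∑ᶠ-zero n (λ τ → trans (𝟙-guard (injective? τ) (λ τ-inj →
          trans (sym (𝟙-× ((τ ∘ f) ≗? u) ((τ ∘ g) ≗? v)))
            (𝟙-no (((τ ∘ f) ≗? u) ×-dec ((τ ∘ g) ≗? v))
              (λ (eqf , eqg) → ¬uv
                ( trans (sym (eqf i)) (trans (cong τ (proj₁ fg)) (eqg j))
                , (λ i′ j′ eq → proj₂ fg i′ j′ (τ-inj (trans (eqf i′) (trans eq (sym (eqg j′)))))))))))
          (*-zeroʳ (𝟙 (injective? τ))))

-- The first two moments of the occurrence counts

module _ (m n : ℕ) (W : (Fin m → Fin n) → ℕ) where

  ∑ᶠ-weighted-+ : (F G : (Fin m → Fin n) → ℕ) → ∑ᶠ m n (λ f → W f * (F f + G f)) ≡ ∑ᶠ m n (λ f → W f * F f) + ∑ᶠ m n (λ f → W f * G f)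
  ∑ᶠ-weighted-+ F G = trans (∑ᶠ-cong m (λ f → *-distribˡ-+ (W f) (F f) (G f))) (∑ᶠ-+ m (λ f → W f * F f) (λ f → W f * G f))

  ∑ᶠ-weighted-*ˡ : ∀ x (F : (Fin m → Fin n) → ℕ) → ∑ᶠ m n (λ f → W f * (x * F f)) ≡ x * ∑ᶠ m n (λ f → W f * F f)
  ∑ᶠ-weighted-*ˡ x F = trans (∑ᶠ-cong m (λ f → swap (W f) x (F f))) (∑ᶠ-*ˡ m x (λ f → W f * F f))
    where
    swap : ∀ a b c → a * (b * c) ≡ b * (a * c)
    swap = solve-∀

  ∑ᶠ-weighted-*ʳ : ∀ x (F : (Fin m → Fin n) → ℕ) → ∑ᶠ m n (λ f → W f * (F f * x)) ≡ ∑ᶠ m n (λ f → W f * F f) * x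
  ∑ᶠ-weighted-*ʳ x F = trans (∑ᶠ-cong m (λ f → sym (*-assoc (W f) (F f) x))) (∑ᶠ-*ʳ m x (λ f → W f * F f))

  ∑ᶠ-weighted-∑ : ∀ {k} (F : (Fin m → Fin n) → Fin k → ℕ) →
    ∑ᶠ m n (λ f → W f * ∑[ i < k ] F f i) ≡ ∑[ i < k ] ∑ᶠ m n (λ f → W f * F f i)
  ∑ᶠ-weighted-∑ F = trans (∑ᶠ-cong m (λ f → *-distribˡ-sum (W f) (F f))) (∑ᶠ-∑-comm m (λ f i → W f * F f i))

  -- Each sum carries its own weight, so this one interchange moves the sum over permutations,
  -- weighted by injectivity, past a sum over increasing maps.
  ∑ᶠ-weighted-comm : ∀ k l (V : (Fin k → Fin l) → ℕ) (F : (Fin m → Fin n) → (Fin k → Fin l) → ℕ) →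
    ∑ᶠ m n (λ f → W f * ∑ᶠ k l (λ g → V g * F f g)) ≡ ∑ᶠ k l (λ g → V g * ∑ᶠ m n (λ f → W f * F f g))
  ∑ᶠ-weighted-comm k l V F = begin
    ∑ᶠ m n (λ f → W f * ∑ᶠ k l (λ g → V g * F f g))
      ≡⟨ ∑ᶠ-cong m (λ f → sym (∑ᶠ-*ˡ k (W f) (λ g → V g * F f g))) ⟩
    ∑ᶠ m n (λ f → ∑ᶠ k l (λ g → W f * (V g * F f g)))
      ≡⟨ ∑ᶠ-comm m k (λ f g → W f * (V g * F f g)) ⟩
    ∑ᶠ k l (λ g → ∑ᶠ m n (λ f → W f * (V g * F f g)))
      ≡⟨ ∑ᶠ-cong k (λ g → ∑ᶠ-weighted-*ˡ (V g) (λ f → F f g)) ⟩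
    ∑ᶠ k l (λ g → V g * ∑ᶠ m n (λ f → W f * F f g)) ∎
    where open ≡-Reasoning

∑ᴵ-cong : ∀ m {n} {F G : (Fin m → Fin n) → ℕ} → (∀ f → Increasing f → F f ≡ G f) → ∑ᴵ m n F ≡ ∑ᴵ m n G
∑ᴵ-cong m eq = ∑ᶠ-cong m (λ f → 𝟙-guard (increasing? f) (eq f))

∑ᴵ-mono : ∀ m {n} {F G : (Fin m → Fin n) → ℕ} → (∀ f → F f ≤ G f) → ∑ᴵ m n F ≤ ∑ᴵ m n G
∑ᴵ-mono m le = ∑ᶠ-mono m (λ f → *-monoʳ-≤ (𝟙 (increasing? f)) (le f))

∑ᴵ≤∑ᶠ : ∀ m {n} (F : (Fin m → Fin n) → ℕ) → ∑ᴵ m n F ≤ ∑ᶠ m n F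
∑ᴵ≤∑ᶠ m F = ∑ᶠ-mono m (λ f → 𝟙-*-≤ (increasing? f) (F f))

∑ᴵ² : ∀ p q n → ((Fin p → Fin n) → (Fin q → Fin n) → ℕ) → ℕ
∑ᴵ² p q n F = ∑ᴵ p n (λ f → ∑ᴵ q n (F f))

module _ (p q n : ℕ) where

  ∑ᴵ²-cong : ∀ {F G : (Fin p → Fin n) → (Fin q → Fin n) → ℕ} →
    (∀ f g → Increasing f → Increasing g → F f g ≡ G f g) → ∑ᴵ² p q n F ≡ ∑ᴵ² p q n G
  ∑ᴵ²-cong eq = ∑ᴵ-cong p (λ f f↑ → ∑ᴵ-cong q (λ g → eq f g f↑))

  ∑ᴵ²-+ : (F G : (Fin p → Fin n) → (Fin q → Fin n) → ℕ) → ∑ᴵ² p q n (λ f g → F f g + G f g) ≡ ∑ᴵ² p q n F + ∑ᴵ² p q n G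
  ∑ᴵ²-+ F G = trans (∑ᴵ-cong p (λ f _ → ∑ᶠ-weighted-+ q n (λ f → 𝟙 (increasing? f)) (F f) (G f)))
    (∑ᶠ-weighted-+ p n (λ f → 𝟙 (increasing? f)) (λ f → ∑ᴵ q n (F f)) (λ f → ∑ᴵ q n (G f)))

  ∑ᴵ²-*ʳ : ∀ x (F : (Fin p → Fin n) → (Fin q → Fin n) → ℕ) → ∑ᴵ² p q n (λ f g → F f g * x) ≡ ∑ᴵ² p q n F * x
  ∑ᴵ²-*ʳ x F = trans (∑ᴵ-cong p (λ f _ → ∑ᶠ-weighted-*ʳ q n (λ f → 𝟙 (increasing? f)) x (F f)))
    (∑ᶠ-weighted-*ʳ p n (λ f → 𝟙 (increasing? f)) x (λ f → ∑ᴵ q n (F f)))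

  ∑ᴵ²-∑ : ∀ {k} (F : Fin k → (Fin p → Fin n) → (Fin q → Fin n) → ℕ) →
    ∑ᴵ² p q n (λ f g → ∑[ i < k ] F i f g) ≡ ∑[ i < k ] ∑ᴵ² p q n (F i)
  ∑ᴵ²-∑ F = trans (∑ᴵ-cong p (λ f _ → ∑ᶠ-weighted-∑ q n (λ f → 𝟙 (increasing? f)) (λ g i → F i f g)))
    (∑ᶠ-weighted-∑ p n (λ f → 𝟙 (increasing? f)) (λ f i → ∑ᴵ q n (F i f)))

  ∑ᴵ²-product : ∀ (F : (Fin p → Fin n) → ℕ) (G : (Fin q → Fin n) → ℕ) → ∑ᴵ² p q n (λ f g → F f * G g) ≡ ∑ᴵ p n F * ∑ᴵ q n G
  ∑ᴵ²-product F G = trans (∑ᴵ-cong p (λ f _ → ∑ᶠ-weighted-*ˡ q n (λ f → 𝟙 (increasing? f)) (F f) G))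
    (∑ᶠ-weighted-*ʳ p n (λ f → 𝟙 (increasing? f)) (∑ᴵ q n G) F)

  ∑ˢ-∑ᴵ²-comm : ∀ {l} (F : (Fin l → Fin l) → (Fin p → Fin n) → (Fin q → Fin n) → ℕ) →
    ∑ˢ l (λ τ → ∑ᴵ² p q n (F τ)) ≡ ∑ᴵ² p q n (λ f g → ∑ˢ l (λ τ → F τ f g))
  ∑ˢ-∑ᴵ²-comm {l} F = trans (∑ᶠ-weighted-comm l l (λ τ → 𝟙 (injective? τ)) p n (λ f → 𝟙 (increasing? f)) (λ τ f → ∑ᴵ q n (F τ f)))
    (∑ᴵ-cong p (λ f _ → ∑ᶠ-weighted-comm l l (λ τ → 𝟙 (injective? τ)) q n (λ f → 𝟙 (increasing? f)) (λ τ → F τ f)))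

-- The condition `j ≢ j′` makes the two coincidences independent constraints on `g`, each of which
-- will save a factor n in the count.
MeetTwice : ∀ {p q n} → (Fin p → Fin n) → (Fin q → Fin n) → Set
MeetTwice f g = ∃[ i ] ∃[ i′ ] ∃[ j ] ∃[ j′ ] (j ≢ j′ × f i ≡ g j × f i′ ≡ g j′)

abstract

  meetTwice? : ∀ {p q n} (f : Fin p → Fin n) (g : Fin q → Fin n) → Dec (MeetTwice f g)
  meetTwice? f g = any? (λ i → any? (λ i′ → any? (λ j → any? (λ j′ →
    ¬? (j ≟ j′) ×-dec (f i ≟ g j) ×-dec (f i′ ≟ g j′)))))

module _ {p q n : ℕ} {f : Fin p → Fin n} {g : Fin q → Fin n} (f-inj : Injective _≡_ _≡_ f) where

  -- The indicators are those of mutually exclusive cases. They are exhaustive because, in the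
  -- absence of a double meeting, every coincidence has the same index in `g`, and then injectivity
  -- of `f` fixes its index in `f` as well.
  meet-partition : 𝟙 (disjoint? f g) + ∑[ i < p ] ∑[ j < q ] 𝟙 (meetAt? i j f g) + 𝟙 (meetTwice? f g) ≡ 1
  meet-partition = cases (meetTwice? f g) (any? (λ i → any? (λ j → f i ≟ g j)))
    where
    sum-of : ∀ {x y z} → 𝟙 (disjoint? f g) ≡ x → ∑[ i < p ] ∑[ j < q ] 𝟙 (meetAt? i j f g) ≡ y → 𝟙 (meetTwice? f g) ≡ z →
             𝟙 (disjoint? f g) + ∑[ i < p ] ∑[ j < q ] 𝟙 (meetAt? i j f g) + 𝟙 (meetTwice? f g) ≡ x + y + z
    sum-of a b c = cong₂ _+_ (cong₂ _+_ a b) c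

    cases : Dec (MeetTwice f g) → Dec (∃[ i ] ∃[ j ] f i ≡ g j) →
      𝟙 (disjoint? f g) + ∑[ i < p ] ∑[ j < q ] 𝟙 (meetAt? i j f g) + 𝟙 (meetTwice? f g) ≡ 1
    cases (yes t@(i , i′ , j , j′ , j≢j′ , eq , eq′)) _ = sum-of
      (𝟙-no (disjoint? f g) (λ f#g → f#g i j eq))
      (∑-zero (λ x → ∑-zero (λ y → 𝟙-no (meetAt? x y f g) (λ (_ , only) →
        j≢j′ (trans (proj₂ (only i j eq)) (sym (proj₂ (only i′ j′ eq′))))))))
      (𝟙-yes (meetTwice? f g) t)
    cases (no ¬t) (no ¬m) = sum-of
      (𝟙-yes (disjoint? f g) (λ i j eq → ¬m (i , j , eq)))
      (∑-zero (λ x → ∑-zero (λ y → 𝟙-no (meetAt? x y f g) (λ (eq , _) → ¬m (x , y , eq)))))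
      (𝟙-no (meetTwice? f g) ¬t)
    cases (no ¬t) (yes (i , j , eq)) = sum-of
      (𝟙-no (disjoint? f g) (λ f#g → f#g i j eq))
      (begin
        ∑[ x < p ] ∑[ y < q ] 𝟙 (meetAt? x y f g)
          ≡⟨ sum-cong-≗ (λ x → sum-cong-≗ (λ y → trans
               (𝟙-⇔ (meetAt? x y f g) ((x ≟ i) ×-dec (y ≟ j)) (at x y) (λ { (refl , refl) → eq , only }))
               (𝟙-× (x ≟ i) (y ≟ j)))) ⟩
        ∑[ x < p ] ∑[ y < q ] (𝟙 (x ≟ i) * 𝟙 (y ≟ j))
          ≡⟨ ∑∑-* (λ x → 𝟙 (x ≟ i)) (λ y → 𝟙 (y ≟ j)) ⟩
        ∑[ x < p ] 𝟙 (x ≟ i) * ∑[ y < q ] 𝟙 (y ≟ j)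
          ≡⟨ cong₂ _*_ (point i) (point j) ⟩
        1 ∎)
      (𝟙-no (meetTwice? f g) ¬t)
      where
      open ≡-Reasoning
      point : ∀ {k} (i : Fin k) → ∑[ x < k ] 𝟙 (x ≟ i) ≡ 1
      point {k} i = trans (sum-cong-≗ {k} (λ x → sym (*-identityʳ (𝟙 (x ≟ i))))) (∑-δ i (λ _ → 1))
      only : ∀ i′ j′ → f i′ ≡ g j′ → i′ ≡ i × j′ ≡ j
      only i′ j′ eq′ with j ≟ j′
      ... | yes refl = f-inj (trans eq′ (sym eq)) , refl
      ... | no  j≢j′ = contradiction (i , i′ , j , j′ , j≢j′ , eq , eq′) ¬t
      at : ∀ x y → MeetAt x y f g → x ≡ i × y ≡ j
      at x y (eq′ , _) = only x y eq′

-- Moments in terms of counts of pairs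

#disjoint #meetTwice : ℕ → ℕ → ℕ → ℕ
#disjoint  p q n = ∑ᴵ² p q n (λ f g → 𝟙 (disjoint? f g))
#meetTwice p q n = ∑ᴵ² p q n (λ f g → 𝟙 (meetTwice? f g))

#meetAt : ∀ {p q} → Fin p → Fin q → ℕ → ℕ
#meetAt {p} {q} i j n = ∑ᴵ² p q n (λ f g → 𝟙 (meetAt? i j f g))

#increasing : ℕ → ℕ → ℕ
#increasing m n = ∑ᴵ m n (λ _ → 1)

occ : ∀ {m n} → Permutation′ m → (Fin n → Fin n) → (Fin m → Fin n) → ℕ
occ π τ f = 𝟙 (increasing? (τ ∘ f ∘ (π ⟨$⟩ˡ_)))

perm-injective : ∀ {m} (π : Permutation′ m) → Injective _≡_ _≡_ (π ⟨$⟩ʳ_)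
perm-injective π eq = trans (sym (inverseˡ π)) (trans (cong (π ⟨$⟩ˡ_) eq) (inverseˡ π))

∑ˢ-one : ∀ n → ∑ˢ n (λ _ → 1) ≡ n !
∑ˢ-one n = trans (∑ᶠ-cong n (λ τ → cong (𝟙 (injective? τ) *_) (sym (𝟙-yes ((τ ∘ (λ ())) ≗? (λ ())) (λ ())))))
  (∑ˢ-fix n {0} refl {λ ()} {λ ()} (λ { {()} }) (λ { {()} }))

-- The choice of positions and the choice of values are independent, and each combination leaves
-- `d !` permutations whatever `π` is.
sum-X : ∀ {m n} d → m + d ≡ n → (π : Permutation′ m) →
        ∑ˢ n (X π) ≡ #increasing m n * (#increasing m n * d !)
sum-X {m} {n} d m+d≡n π = begin
  ∑ˢ n (X π)
    ≡⟨ ∑ᶠ-cong n (λ τ → cong (𝟙 (injective? τ) *_) (trans (X≡∑ π τ) (∑ᴵ-cong m (λ f _ → 𝟙-occurrence π τ f)))) ⟩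
  ∑ˢ n (λ τ → ∑ᴵ² m m n (λ f a → 𝟙 ((τ ∘ f) ≗? (a ∘ (π ⟨$⟩ʳ_)))))
    ≡⟨ ∑ˢ-∑ᴵ²-comm m m n (λ τ f a → 𝟙 ((τ ∘ f) ≗? (a ∘ (π ⟨$⟩ʳ_)))) ⟩
  ∑ᴵ² m m n (λ f a → ∑ˢ n (λ τ → 𝟙 ((τ ∘ f) ≗? (a ∘ (π ⟨$⟩ʳ_)))))
    ≡⟨ ∑ᴵ²-cong m m n (λ f a f↑ a↑ → trans (∑ˢ-fix d m+d≡n (increasing⇒injective f↑) (perm-injective π ∘ increasing⇒injective a↑)) (sym (*-identityˡ _))) ⟩
  ∑ᴵ² m m n (λ f a → 1 * d !)
    ≡⟨ trans (∑ᴵ²-*ʳ m m n (d !) (λ _ _ → 1)) (cong (_* d !) (∑ᴵ²-product m m n (λ _ → 1) (λ _ → 1))) ⟩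
  #increasing m n * #increasing m n * d !
    ≡⟨ *-assoc (#increasing m n) _ _ ⟩
  #increasing m n * (#increasing m n * d !) ∎
  where open ≡-Reasoning

module _ {m n : ℕ} (π₁ π₂ : Permutation′ m) where

  jointOcc : (Fin m → Fin n) → (Fin m → Fin n) → ℕ
  jointOcc f g = ∑ˢ n (λ τ → occ π₁ τ f * occ π₂ τ g)

  jointOcc≤n! : ∀ f g → jointOcc f g ≤ n !
  jointOcc≤n! f g = ≤-trans
    (∑ᶠ-mono n (λ τ → *-monoʳ-≤ (𝟙 (injective? τ)) (*-mono-≤ (𝟙≤1 (increasing? (τ ∘ f ∘ (π₁ ⟨$⟩ˡ_)))) (𝟙≤1 (increasing? (τ ∘ g ∘ (π₂ ⟨$⟩ˡ_)))))))
    (≤-reflexive (∑ˢ-one n))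

  jointOcc-values : ∀ f g → jointOcc f g ≡ ∑ᴵ² m m n (λ a b →
    ∑ˢ n (λ τ → 𝟙 ((τ ∘ f) ≗? (a ∘ (π₁ ⟨$⟩ʳ_))) * 𝟙 ((τ ∘ g) ≗? (b ∘ (π₂ ⟨$⟩ʳ_)))))
  jointOcc-values f g = trans
    (∑ᶠ-cong n (λ τ → cong (𝟙 (injective? τ) *_)
      (trans (cong₂ _*_ (𝟙-occurrence π₁ τ f) (𝟙-occurrence π₂ τ g))
        (sym (∑ᴵ²-product m m n (λ a → 𝟙 ((τ ∘ f) ≗? (a ∘ (π₁ ⟨$⟩ʳ_)))) (λ b → 𝟙 ((τ ∘ g) ≗? (b ∘ (π₂ ⟨$⟩ʳ_)))))))))
    (∑ˢ-∑ᴵ²-comm m m n (λ τ a b → 𝟙 ((τ ∘ f) ≗? (a ∘ (π₁ ⟨$⟩ʳ_))) * 𝟙 ((τ ∘ g) ≗? (b ∘ (π₂ ⟨$⟩ʳ_)))))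

  -- Precomposing the value lists with `π₁` and `π₂` only reorders them, so their disjointness is
  -- unaffected and the patterns drop out of this term.
  jointOcc-disjoint : ∀ d → m + m + d ≡ n → ∀ {f g} → Increasing f → Increasing g → Disjoint f g →
    jointOcc f g ≡ #disjoint m m n * d !
  jointOcc-disjoint d 2m+d≡n {f} {g} f↑ g↑ f#g = trans (jointOcc-values f g) (trans
    (∑ᴵ²-cong m m n (λ a b a↑ b↑ → trans
      (∑ˢ-fix-disjoint (increasing⇒injective f↑) (increasing⇒injective g↑)
        (perm-injective π₁ ∘ increasing⇒injective a↑) (perm-injective π₂ ∘ increasing⇒injective b↑) d 2m+d≡n f#g)
      (cong (_* d !) (𝟙-⇔ (disjoint? (a ∘ (π₁ ⟨$⟩ʳ_)) (b ∘ (π₂ ⟨$⟩ʳ_))) (disjoint? a b)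
        (λ a#b i j eq → a#b (π₁ ⟨$⟩ˡ i) (π₂ ⟨$⟩ˡ j) (trans (cong a (inverseʳ π₁)) (trans eq (cong b (sym (inverseʳ π₂))))))
        (λ a#b i j → a#b _ _)))))
    (∑ᴵ²-*ʳ m m n (d !) (λ a b → 𝟙 (disjoint? a b))))

module _ {k n : ℕ} (π₁ π₂ : Permutation′ (suc k)) where

  private m = suc k

  -- Here the patterns do matter: reordering by `π₁` and `π₂` moves the meeting indices of the value
  -- lists. This is the source of the second bracket in `bracketSum`. The shared entry leaves
  -- `m + k`, that is 2m - 1, prescribed positions.
  jointOcc-meetAt : ∀ e → m + k + e ≡ n → ∀ {f g} → Increasing f → Increasing g → ∀ {i j} → MeetAt i j f g →
    jointOcc {m} {n} π₁ π₂ f g ≡ #meetAt (π₁ ⟨$⟩ʳ i) (π₂ ⟨$⟩ʳ j) n * e !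
  jointOcc-meetAt e 2m-1+e≡n {f} {g} f↑ g↑ {i} {j} fg = trans (jointOcc-values π₁ π₂ f g) (trans
    (∑ᴵ²-cong m m n (λ a b a↑ b↑ → trans
      (∑ˢ-fix-meetAt (increasing⇒injective f↑) (increasing⇒injective g↑)
        (perm-injective π₁ ∘ increasing⇒injective a↑) (perm-injective π₂ ∘ increasing⇒injective b↑) e 2m-1+e≡n fg)
      (cong (_* e !) (𝟙-⇔ (meetAt? i j (a ∘ (π₁ ⟨$⟩ʳ_)) (b ∘ (π₂ ⟨$⟩ʳ_))) (meetAt? (π₁ ⟨$⟩ʳ i) (π₂ ⟨$⟩ʳ j) a b)
        (λ (eq , only) → eq , λ i′ j′ eq′ →
          let (p , q) = only (π₁ ⟨$⟩ˡ i′) (π₂ ⟨$⟩ˡ j′) (trans (cong a (inverseʳ π₁)) (trans eq′ (cong b (sym (inverseʳ π₂)))))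
          in trans (sym (inverseʳ π₁)) (cong (π₁ ⟨$⟩ʳ_) p) , trans (sym (inverseʳ π₂)) (cong (π₂ ⟨$⟩ʳ_) q))
        (λ (eq , only) → eq , λ i′ j′ eq′ →
          let (p , q) = only _ _ eq′ in perm-injective π₁ p , perm-injective π₂ q)))))
    (∑ᴵ²-*ʳ m m n (e !) (λ a b → 𝟙 (meetAt? (π₁ ⟨$⟩ʳ i) (π₂ ⟨$⟩ʳ j) a b))))

  -- These pairs lie below the order of interest, so their joint counts are never evaluated; the
  -- trivial bound by `n !` suffices.
  remainder : ℕ
  remainder = ∑ᴵ² m m n (λ f g → 𝟙 (meetTwice? f g) * jointOcc π₁ π₂ f g)

  remainder≤ : remainder ≤ #meetTwice m m n * n !
  remainder≤ = ≤-trans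
    (∑ᴵ-mono m {n} (λ f → ∑ᴵ-mono m {n} {G = λ g → 𝟙 (meetTwice? f g) * n !} (λ g → *-monoʳ-≤ (𝟙 (meetTwice? f g)) (jointOcc≤n! π₁ π₂ f g))))
    (≤-reflexive (∑ᴵ²-*ʳ m m n (n !) (λ f g → 𝟙 (meetTwice? f g))))

  sum-XX : ∀ d → m + m + d ≡ n → ∑ˢ n (λ τ → X π₁ τ * X π₂ τ) ≡
    #disjoint m m n * (#disjoint m m n * d !)
    + ∑[ i < m ] ∑[ j < m ] (#meetAt i j n * (#meetAt (π₁ ⟨$⟩ʳ i) (π₂ ⟨$⟩ʳ j) n * suc d !))
    + remainder
  sum-XX d 2m+d≡n = begin
    ∑ˢ n (λ τ → X π₁ τ * X π₂ τ)
      ≡⟨ ∑ᶠ-cong n (λ τ → cong (𝟙 (injective? τ) *_) (trans (cong₂ _*_ (X≡∑ π₁ τ) (X≡∑ π₂ τ))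
           (sym (∑ᴵ²-product m m n (occ π₁ τ) (occ π₂ τ))))) ⟩
    ∑ˢ n (λ τ → ∑ᴵ² m m n (λ f g → occ π₁ τ f * occ π₂ τ g))
      ≡⟨ ∑ˢ-∑ᴵ²-comm m m n (λ τ f g → occ π₁ τ f * occ π₂ τ g) ⟩
    ∑ᴵ² m m n H
      ≡⟨ ∑ᴵ²-cong m m n (λ f g f↑ g↑ → split f g f↑ g↑) ⟩
    ∑ᴵ² m m n (λ f g → D f g + M f g + 𝟙 (meetTwice? f g) * H f g)
      ≡⟨ trans (∑ᴵ²-+ m m n (λ f g → D f g + M f g) (λ f g → 𝟙 (meetTwice? f g) * H f g))
           (cong (_+ remainder) (∑ᴵ²-+ m m n D M)) ⟩
    ∑ᴵ² m m n D + ∑ᴵ² m m n M + remainder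
      ≡⟨ cong (_+ remainder) (cong₂ _+_
           (∑ᴵ²-*ʳ m m n (#disjoint m m n * d !) (λ f g → 𝟙 (disjoint? f g)))
           (trans (∑ᴵ²-∑ m m n (λ i f g → ∑[ j < m ] M′ i j f g)) (sum-cong-≗ (λ i → trans (∑ᴵ²-∑ m m n (M′ i)) (sum-cong-≗ (λ j →
             ∑ᴵ²-*ʳ m m n (#meetAt (π₁ ⟨$⟩ʳ i) (π₂ ⟨$⟩ʳ j) n * suc d !) (λ f g → 𝟙 (meetAt? i j f g)))))))) ⟩
    #disjoint m m n * (#disjoint m m n * d !)
      + ∑[ i < m ] ∑[ j < m ] (#meetAt i j n * (#meetAt (π₁ ⟨$⟩ʳ i) (π₂ ⟨$⟩ʳ j) n * suc d !))
      + remainder ∎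
    where
    open ≡-Reasoning
    H D M : (Fin m → Fin n) → (Fin m → Fin n) → ℕ
    H = jointOcc π₁ π₂
    D f g = 𝟙 (disjoint? f g) * (#disjoint m m n * d !)
    M′ : Fin m → Fin m → (Fin m → Fin n) → (Fin m → Fin n) → ℕ
    M′ i j f g = 𝟙 (meetAt? i j f g) * (#meetAt (π₁ ⟨$⟩ʳ i) (π₂ ⟨$⟩ʳ j) n * suc d !)
    M f g = ∑[ i < m ] ∑[ j < m ] M′ i j f g
    -- A pair with one common position prescribes one value fewer, hence `suc d` free positions in
    -- place of `d`.
    m+k+1+d : m + k + suc d ≡ n
    m+k+1+d = trans (trans (+-suc (m + k) d) (cong (_+ d) (sym (+-suc m k)))) 2m+d≡n
    -- The joint count is multiplied by the partition of one from `meet-partition`, and each exact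
    -- count is substituted under its own indicator.
    split : ∀ f g → Increasing f → Increasing g → H f g ≡ D f g + M f g + 𝟙 (meetTwice? f g) * H f g
    split f g f↑ g↑ = begin
      H f g
        ≡⟨ sym (trans (cong (_* H f g) (meet-partition {f = f} {g} (increasing⇒injective f↑))) (*-identityˡ _)) ⟩
      (𝟙 (disjoint? f g) + ∑[ i < m ] ∑[ j < m ] 𝟙 (meetAt? i j f g) + 𝟙 (meetTwice? f g)) * H f g
        ≡⟨ trans (*-distribʳ-+ (H f g) (𝟙 (disjoint? f g) + ∑[ i < m ] ∑[ j < m ] 𝟙 (meetAt? i j f g)) _)
             (cong (_+ 𝟙 (meetTwice? f g) * H f g) (*-distribʳ-+ (H f g) (𝟙 (disjoint? f g)) _)) ⟩
      𝟙 (disjoint? f g) * H f g + (∑[ i < m ] ∑[ j < m ] 𝟙 (meetAt? i j f g)) * H f g + 𝟙 (meetTwice? f g) * H f g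
        ≡⟨ cong (_+ 𝟙 (meetTwice? f g) * H f g) (cong₂ _+_
             (𝟙-guard (disjoint? f g) (jointOcc-disjoint π₁ π₂ d 2m+d≡n f↑ g↑))
             (trans (*-distribʳ-sum (H f g) (λ i → ∑[ j < m ] 𝟙 (meetAt? i j f g))) (sum-cong-≗ (λ i →
               trans (*-distribʳ-sum (H f g) (λ j → 𝟙 (meetAt? i j f g))) (sum-cong-≗ (λ j →
                 𝟙-guard (meetAt? i j f g) (jointOcc-meetAt (suc d) m+k+1+d f↑ g↑))))))) ⟩
      D f g + M f g + 𝟙 (meetTwice? f g) * H f g ∎

-- Counting increasing pairs

suc-consF : ∀ {m n} a (f : Fin m → Fin n) → consF (suc a) (suc ∘ f) ≗ (suc ∘ consF a f)
suc-consF a f zero    = refl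
suc-consF a f (suc i) = refl

-- Any function that takes the value zero contributes nothing, so only functions of the form
-- `suc ∘ f` remain.
∑ᶠ-shift : ∀ m {n} {F : (Fin m → Fin (suc n)) → ℕ} → Ext F → (∀ f i → f i ≡ zero → F f ≡ 0) →
           ∑ᶠ m (suc n) F ≡ ∑ᶠ m n (λ f → F (suc ∘ f))
∑ᶠ-shift zero    ext vanish = ext (λ ())
∑ᶠ-shift (suc m) {n} {F} ext vanish = cong₂ _+_
  (∑ᶠ-zero m (λ f → vanish (consF zero f) zero refl))
  (sum-cong-≗ {n} (λ a → trans
    (∑ᶠ-shift m (λ eq → ext (consF-cong (suc a) eq)) (λ f i → vanish (consF (suc a) f) (suc i)))
    (∑ᶠ-cong m (λ f → ext (suc-consF a f)))))

suc∘_ : ∀ {m n} → (Fin m → Fin n) → Fin m → Fin (suc n)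
suc∘ f = suc ∘ f

0∷_ : ∀ {m n} → (Fin m → Fin n) → Fin (suc m) → Fin (suc n)
0∷ f = consF zero (suc ∘ f)

-- An increasing map can take the value zero only at its first argument. Hence it either starts at
-- zero or avoids it, which is Pascal's rule at the level of sums.
∑ᴵ-suc : ∀ m n {G : (Fin (suc m) → Fin (suc n)) → ℕ} → Ext G →
         ∑ᴵ (suc m) (suc n) G ≡ ∑ᴵ m n (λ f → G (0∷ f)) + ∑ᴵ (suc m) n (λ f → G (suc ∘ f))
∑ᴵ-suc m n {G} ext = cong₂ _+_
  (trans
    (∑ᶠ-shift m (λ eq → wG-ext (consF-cong zero eq)) (λ f i eq → vanish (consF zero f) (suc i) (λ ()) eq))
    (∑ᶠ-cong m (λ f → cong (_* G (0∷ f)) (𝟙-⇔ (increasing? (0∷ f)) (increasing? f) (λ inc i j i<j → s≤s⁻¹ (inc (suc i) (suc j) (s≤s i<j)))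
      (λ inc → λ { zero (suc j) _ → s≤s z≤n ; (suc i) (suc j) i<j → s≤s (inc i j (s≤s⁻¹ i<j)) })))))
  (trans
    (sum-cong-≗ {n} (λ a → trans
      (∑ᶠ-shift m (λ eq → wG-ext (consF-cong (suc a) eq)) (λ f i eq → vanish (consF (suc a) f) (suc i) (λ ()) eq))
      (∑ᶠ-cong m (λ f → wG-ext (suc-consF a f)))))
    (∑ᶠ-cong (suc m) (λ f → cong (_* G (suc ∘ f)) (𝟙-⇔ (increasing? (suc ∘ f)) (increasing? f)
      (λ inc i j i<j → s≤s⁻¹ (inc i j i<j)) (λ inc i j i<j → s≤s (inc i j i<j))))))
  where
  wG : (Fin (suc m) → Fin (suc n)) → ℕ
  wG f = 𝟙 (increasing? f) * G f
  wG-ext : Ext wG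
  wG-ext eq = cong₂ _*_ (increasing?-ext eq) (ext eq)
  vanish : ∀ f i → i ≢ zero → f i ≡ zero → wG f ≡ 0
  vanish f zero    i≢0 eq = contradiction refl i≢0
  vanish f (suc i) _   eq = cong (_* G f) (𝟙-no (increasing? f) (λ inc →
    contradiction (subst (f zero <ᶠ_) eq (inc zero (suc i) (s≤s z≤n))) λ ()))

#increasing≡C : ∀ m n → #increasing m n ≡ n C m
#increasing≡C zero    n       = trans (*-identityʳ _) (𝟙-yes (increasing? _) (λ ()))
#increasing≡C (suc m) zero    = refl
#increasing≡C (suc m) (suc n) = trans (∑ᴵ-suc m n {λ _ → 1} (λ _ → refl))
  (trans (cong₂ _+_ (#increasing≡C m n) (#increasing≡C (suc m) n)) (nCk+nC[k+1]≡[n+1]C[k+1] n m))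

∑ᴵ-empty : ∀ {n} (G : (Fin 0 → Fin n) → ℕ) → ∑ᴵ 0 n G ≡ G (λ ())
∑ᴵ-empty G = trans (cong (_* G (λ ())) (𝟙-yes (increasing? _) (λ ()))) (*-identityˡ _)

module _ (p q n : ℕ) (F : (Fin (suc p) → Fin (suc n)) → (Fin (suc q) → Fin (suc n)) → ℕ)
         (ext : ∀ {f f′ g g′} → f ≗ f′ → g ≗ g′ → F f g ≡ F f′ g′) where

  -- Four cases, according to which of the two images contain zero. All exact counts of pairs come
  -- from this recurrence.
  ∑ᴵ²-suc : ∑ᴵ² (suc p) (suc q) (suc n) F ≡
    (∑ᴵ² p q n (λ f g → F (0∷ f) (0∷ g)) + ∑ᴵ² p (suc q) n (λ f g → F (0∷ f) (suc∘ g)))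
    + (∑ᴵ² (suc p) q n (λ f g → F (suc∘ f) (0∷ g)) + ∑ᴵ² (suc p) (suc q) n (λ f g → F (suc∘ f) (suc∘ g)))
  ∑ᴵ²-suc = trans
    (∑ᴵ-suc p n {λ f → ∑ᴵ (suc q) (suc n) (F f)} (λ eq → ∑ᴵ-cong (suc q) (λ g _ → ext {g = g} {g} eq (λ _ → refl))))
    (cong₂ _+_
      (trans (∑ᴵ-cong p (λ f _ → ∑ᴵ-suc q n {F (0∷ f)} (ext {0∷ f} {0∷ f} (λ _ → refl))))
        (∑ᶠ-weighted-+ p n (λ f → 𝟙 (increasing? f)) (λ f → ∑ᴵ q n (λ g → F (0∷ f) (0∷ g))) (λ f → ∑ᴵ (suc q) n (λ g → F (0∷ f) (suc∘ g)))))
      (trans (∑ᴵ-cong (suc p) (λ f _ → ∑ᴵ-suc q n {F (suc∘ f)} (ext {suc∘ f} {suc∘ f} (λ _ → refl))))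
        (∑ᶠ-weighted-+ (suc p) n (λ f → 𝟙 (increasing? f)) (λ f → ∑ᴵ q n (λ g → F (suc∘ f) (0∷ g))) (λ f → ∑ᴵ (suc q) n (λ g → F (suc∘ f) (suc∘ g))))))

∑ᴵ²-zero : ∀ p q n {F : (Fin p → Fin n) → (Fin q → Fin n) → ℕ} → (∀ f g → F f g ≡ 0) → ∑ᴵ² p q n F ≡ 0
∑ᴵ²-zero p q n eq = ∑ᶠ-zero p (λ f → trans
  (cong (𝟙 (increasing? f) *_) (∑ᶠ-zero q (λ g → trans (cong (𝟙 (increasing? g) *_) (eq f g)) (*-zeroʳ (𝟙 (increasing? g))))))
  (*-zeroʳ (𝟙 (increasing? f))))

module _ {p q n : ℕ} where

  disjoint-cong : {f f′ : Fin p → Fin n} {g g′ : Fin q → Fin n} → f ≗ f′ → g ≗ g′ → Disjoint f g → Disjoint f′ g′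
  disjoint-cong f≗ g≗ f#g i j eq = f#g i j (trans (f≗ i) (trans eq (sym (g≗ j))))

  disjoint?-ext : {f f′ : Fin p → Fin n} {g g′ : Fin q → Fin n} → f ≗ f′ → g ≗ g′ → 𝟙 (disjoint? f g) ≡ 𝟙 (disjoint? f′ g′)
  disjoint?-ext {f} {f′} {g} {g′} f≗ g≗ = 𝟙-⇔ (disjoint? f g) (disjoint? f′ g′) (disjoint-cong f≗ g≗) (disjoint-cong (sym ∘ f≗) (sym ∘ g≗))

  meetAt-cong : ∀ {i j} {f f′ : Fin p → Fin n} {g g′ : Fin q → Fin n} → f ≗ f′ → g ≗ g′ → MeetAt i j f g → MeetAt i j f′ g′
  meetAt-cong f≗ g≗ (eq , only) = trans (sym (f≗ _)) (trans eq (g≗ _)) , λ i′ j′ eq′ → only i′ j′ (trans (f≗ i′) (trans eq′ (sym (g≗ j′))))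

  meetAt?-ext : ∀ i j {f f′ : Fin p → Fin n} {g g′ : Fin q → Fin n} → f ≗ f′ → g ≗ g′ → 𝟙 (meetAt? i j f g) ≡ 𝟙 (meetAt? i j f′ g′)
  meetAt?-ext i j {f} {f′} {g} {g′} f≗ g≗ = 𝟙-⇔ (meetAt? i j f g) (meetAt? i j f′ g′) (meetAt-cong f≗ g≗) (meetAt-cong (sym ∘ f≗) (sym ∘ g≗))

  module _ (f : Fin p → Fin n) (g : Fin q → Fin n) where

    disjoint-0+ : 𝟙 (disjoint? (0∷ f) (suc∘ g)) ≡ 𝟙 (disjoint? f g)
    disjoint-0+ = 𝟙-⇔ (disjoint? (0∷ f) (suc∘ g)) (disjoint? f g)
      (λ f#g i j eq → f#g (suc i) j (cong suc eq))
      (λ f#g → λ { zero j () ; (suc i) j eq → f#g i j (suc-injective eq) })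

    disjoint-+0 : 𝟙 (disjoint? (suc∘ f) (0∷ g)) ≡ 𝟙 (disjoint? f g)
    disjoint-+0 = 𝟙-⇔ (disjoint? (suc∘ f) (0∷ g)) (disjoint? f g)
      (λ f#g i j eq → f#g i (suc j) (cong suc eq))
      (λ f#g → λ { i zero () ; i (suc j) eq → f#g i j (suc-injective eq) })

    disjoint-++ : 𝟙 (disjoint? (suc∘ f) (suc∘ g)) ≡ 𝟙 (disjoint? f g)
    disjoint-++ = 𝟙-⇔ (disjoint? (suc∘ f) (suc∘ g)) (disjoint? f g)
      (λ f#g i j eq → f#g i j (cong suc eq)) (λ f#g i j eq → f#g i j (suc-injective eq))

    -- The shared zero is already the one permitted coincidence, so the rest of the pair must be
    -- disjoint.
    meetAt-00 : 𝟙 (meetAt? zero zero (0∷ f) (0∷ g)) ≡ 𝟙 (disjoint? f g)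
    meetAt-00 = 𝟙-⇔ (meetAt? zero zero (0∷ f) (0∷ g)) (disjoint? f g)
      (λ (_ , only) i j eq → contradiction (proj₁ (only (suc i) (suc j) (cong suc eq))) λ ())
      (λ f#g → refl , λ { zero zero _ → refl , refl ; zero (suc j) () ; (suc i) zero () ; (suc i) (suc j) eq → contradiction (suc-injective eq) (f#g i j) })

    meetAt-0+ : ∀ i j → 𝟙 (meetAt? (suc i) j (0∷ f) (suc∘ g)) ≡ 𝟙 (meetAt? i j f g)
    meetAt-0+ i j = 𝟙-⇔ (meetAt? (suc i) j (0∷ f) (suc∘ g)) (meetAt? i j f g)
      (λ (eq , only) → suc-injective eq , λ i′ j′ eq′ → let (x , y) = only (suc i′) j′ (cong suc eq′) in suc-injective x , y)
      (λ (eq , only) → cong suc eq , λ { zero j′ () ; (suc i′) j′ eq′ → let (x , y) = only i′ j′ (suc-injective eq′) in cong suc x , y })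

    meetAt-+0 : ∀ i j → 𝟙 (meetAt? i (suc j) (suc∘ f) (0∷ g)) ≡ 𝟙 (meetAt? i j f g)
    meetAt-+0 i j = 𝟙-⇔ (meetAt? i (suc j) (suc∘ f) (0∷ g)) (meetAt? i j f g)
      (λ (eq , only) → suc-injective eq , λ i′ j′ eq′ → let (x , y) = only i′ (suc j′) (cong suc eq′) in x , suc-injective y)
      (λ (eq , only) → cong suc eq , λ { i′ zero () ; i′ (suc j′) eq′ → let (x , y) = only i′ j′ (suc-injective eq′) in x , cong suc y })

    meetAt-++ : ∀ i j → 𝟙 (meetAt? i j (suc∘ f) (suc∘ g)) ≡ 𝟙 (meetAt? i j f g)
    meetAt-++ i j = 𝟙-⇔ (meetAt? i j (suc∘ f) (suc∘ g)) (meetAt? i j f g)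
      (λ (eq , only) → suc-injective eq , λ i′ j′ eq′ → only i′ j′ (cong suc eq′))
      (λ (eq , only) → cong suc eq , λ i′ j′ eq′ → only i′ j′ (suc-injective eq′))

module _ {p q n : ℕ} (f : Fin p → Fin n) (g : Fin q → Fin n) where

  meetAt-00-suc : ∀ {i : Fin (suc p)} {j : Fin (suc q)} → ¬ (i ≡ zero × j ≡ zero) → 𝟙 (meetAt? i j (0∷ f) (0∷ g)) ≡ 0
  meetAt-00-suc {i} {j} ij≢0 = 𝟙-no (meetAt? i j (0∷ f) (0∷ g)) λ (_ , only) →
    let (x , y) = only zero zero refl in ij≢0 (sym x , sym y)

-- The union is a set of `p + q` values, of which `f` takes `p`. In the recurrence zero belongs to
-- `f`, to `g` or to neither, and the resulting terms are the expansion of a product of two Pascal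
-- sums.
#disjoint≡C : ∀ p q n → #disjoint p q n ≡ (n C (p + q)) * ((p + q) C p)
#disjoint≡C zero q n = begin
  ∑ᴵ 0 n (λ f → ∑ᴵ q n (λ g → 𝟙 (disjoint? f g)))  ≡⟨ ∑ᴵ-empty (λ f → ∑ᴵ q n (λ g → 𝟙 (disjoint? f g))) ⟩
  ∑ᴵ q n (λ g → 𝟙 (disjoint? {0} (λ ()) g))        ≡⟨ ∑ᴵ-cong q (λ g _ → 𝟙-yes (disjoint? (λ ()) g) (λ ())) ⟩
  #increasing q n                                   ≡⟨ #increasing≡C q n ⟩
  n C q                                             ≡⟨ sym (*-identityʳ _) ⟩
  (n C q) * 1                                         ∎
  where open ≡-Reasoning
#disjoint≡C p@(suc _) zero n = begin
  ∑ᴵ p n (λ f → ∑ᴵ 0 n (λ g → 𝟙 (disjoint? f g)))  ≡⟨ ∑ᴵ-cong p {n} (λ f _ → trans (∑ᴵ-empty (λ g → 𝟙 (disjoint? f g))) (𝟙-yes (disjoint? f (λ ())) (λ i ()))) ⟩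
  #increasing p n                                   ≡⟨ #increasing≡C p n ⟩
  n C p                                             ≡⟨ sym (*-identityʳ _) ⟩
  (n C p) * 1                                         ≡⟨ cong₂ (λ x y → (n C x) * y) (sym (+-identityʳ p)) (trans (sym (nCn≡1 p)) (cong (_C p) (sym (+-identityʳ p)))) ⟩
  (n C (p + 0)) * ((p + 0) C p)                       ∎
  where open ≡-Reasoning
#disjoint≡C (suc p) (suc q) zero = refl
#disjoint≡C (suc p) (suc q) (suc n) = begin
  #disjoint (suc p) (suc q) (suc n)
    ≡⟨ ∑ᴵ²-suc p q n (λ f g → 𝟙 (disjoint? f g)) disjoint?-ext ⟩
  (∑ᴵ² p q n (λ f g → 𝟙 (disjoint? (0∷ f) (0∷ g))) + ∑ᴵ² p (suc q) n (λ f g → 𝟙 (disjoint? (0∷ f) (suc∘ g))))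
    + (∑ᴵ² (suc p) q n (λ f g → 𝟙 (disjoint? (suc∘ f) (0∷ g))) + ∑ᴵ² (suc p) (suc q) n (λ f g → 𝟙 (disjoint? (suc∘ f) (suc∘ g))))
    ≡⟨ cong₂ _+_
         (cong₂ _+_ (∑ᴵ²-zero p q n (λ f g → 𝟙-no (disjoint? (0∷ f) (0∷ g)) (λ f#g → f#g zero zero refl)))
           (trans (∑ᴵ²-cong p (suc q) n (λ f g _ _ → disjoint-0+ f g)) (#disjoint≡C p (suc q) n)))
         (cong₂ _+_ (trans (∑ᴵ²-cong (suc p) q n (λ f g _ _ → disjoint-+0 f g)) (trans (#disjoint≡C (suc p) q n)
             (cong (λ s → (n C s) * (s C suc p)) (sym (+-suc p q)))))
           (trans (∑ᴵ²-cong (suc p) (suc q) n (λ f g _ _ → disjoint-++ f g)) (#disjoint≡C (suc p) (suc q) n))) ⟩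
  (n C s) * (s C p) + ((n C s) * (s C suc p) + (n C suc s) * (suc s C suc p))
    ≡⟨ cong (λ x → (n C s) * (s C p) + ((n C s) * (s C suc p) + (n C suc s) * x)) (sym (nCk+nC[k+1]≡[n+1]C[k+1] s p)) ⟩
  (n C s) * (s C p) + ((n C s) * (s C suc p) + (n C suc s) * (s C p + s C suc p))
    ≡⟨ collect (n C s) (n C suc s) (s C p) (s C suc p) ⟩
  (n C s + n C suc s) * (s C p + s C suc p)
    ≡⟨ cong₂ _*_ (nCk+nC[k+1]≡[n+1]C[k+1] n s) (nCk+nC[k+1]≡[n+1]C[k+1] s p) ⟩
  (suc n C suc s) * (suc s C suc p) ∎
  where
  open ≡-Reasoning
  s = p + suc q
  collect : ∀ a b x y → a * x + (a * y + b * (x + y)) ≡ (a + b) * (x + y)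
  collect = solve-∀

-- The increasing pairs meeting exactly at (i , j) choose their suc (p + q) values, which then arise by
-- shuffling independently the entries before and the entries after the common value.
#meetAt≡C : ∀ {p q} (i : Fin (suc p)) (j : Fin (suc q)) n →
  #meetAt i j n ≡ (n C suc (p + q)) * (((toℕ i + toℕ j) C toℕ i) * (((p ∸ toℕ i) + (q ∸ toℕ j)) C (p ∸ toℕ i)))
#meetAt≡C i j zero = refl
#meetAt≡C {p} {q} i j (suc n) = begin
  #meetAt i j (suc n)
    ≡⟨ ∑ᴵ²-suc p q n (λ f g → 𝟙 (meetAt? i j f g)) (meetAt?-ext i j) ⟩
  (∑ᴵ² p q n (λ f g → 𝟙 (meetAt? i j (0∷ f) (0∷ g))) + ∑ᴵ² p (suc q) n (λ f g → 𝟙 (meetAt? i j (0∷ f) (suc∘ g))))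
    + (∑ᴵ² (suc p) q n (λ f g → 𝟙 (meetAt? i j (suc∘ f) (0∷ g))) + ∑ᴵ² (suc p) (suc q) n (λ f g → 𝟙 (meetAt? i j (suc∘ f) (suc∘ g))))
    ≡⟨ cong (λ x → lower i j + (∑ᴵ² (suc p) q n (λ f g → 𝟙 (meetAt? i j (suc∘ f) (0∷ g))) + x))
         (trans (∑ᴵ²-cong (suc p) (suc q) n (λ f g _ _ → meetAt-++ f g i j)) (#meetAt≡C i j n)) ⟩
  lower i j + (∑ᴵ² (suc p) q n (λ f g → 𝟙 (meetAt? i j (suc∘ f) (0∷ g))) + (n C suc (p + q)) * b i j)
    ≡⟨ sym (+-assoc (lower i j) _ _) ⟩
  lower i j + ∑ᴵ² (suc p) q n (λ f g → 𝟙 (meetAt? i j (suc∘ f) (0∷ g))) + (n C suc (p + q)) * b i j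
    ≡⟨ cong (_+ (n C suc (p + q)) * b i j) (head-step i j) ⟩
  (n C (p + q)) * b i j + (n C suc (p + q)) * b i j
    ≡⟨ sym (*-distribʳ-+ (b i j) (n C (p + q)) _) ⟩
  (n C (p + q) + n C suc (p + q)) * b i j
    ≡⟨ cong (_* b i j) (nCk+nC[k+1]≡[n+1]C[k+1] n (p + q)) ⟩
  (suc n C suc (p + q)) * b i j ∎
  where
  open ≡-Reasoning
  b : ∀ {p q} → Fin (suc p) → Fin (suc q) → ℕ
  b {p} {q} i j = ((toℕ i + toℕ j) C toℕ i) * (((p ∸ toℕ i) + (q ∸ toℕ j)) C (p ∸ toℕ i))
  lower : ∀ {p q} → Fin (suc p) → Fin (suc q) → ℕ
  lower {p} {q} i j = ∑ᴵ² p q n (λ f g → 𝟙 (meetAt? i j (0∷ f) (0∷ g))) + ∑ᴵ² p (suc q) n (λ f g → 𝟙 (meetAt? i j (0∷ f) (suc∘ g)))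
  -- These are the pairs whose union contains zero, so `p + q` further values are chosen from `n`.
  -- If the meeting is not at the two first entries, zero belongs to exactly one of the maps and
  -- precedes the common value; removing it gives Pascal's rule in the first factor of `b`. If the
  -- meeting is at the first entries, zero is the common value and the remainder is a disjoint pair.
  head-step : ∀ {p q} (i : Fin (suc p)) (j : Fin (suc q)) →
    lower i j + ∑ᴵ² (suc p) q n (λ f g → 𝟙 (meetAt? i j (suc∘ f) (0∷ g))) ≡ (n C (p + q)) * b i j
  head-step {p} {q} zero zero = begin
    lower {p} {q} zero zero + ∑ᴵ² (suc p) q n (λ f g → 𝟙 (meetAt? zero zero (suc∘ f) (0∷ g)))
      ≡⟨ cong₂ _+_ (cong₂ _+_
           (trans (∑ᴵ²-cong p q n (λ f g _ _ → meetAt-00 f g)) (#disjoint≡C p q n))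
           (∑ᴵ²-zero p (suc q) n (λ f g → 𝟙-no (meetAt? zero zero (0∷ f) (suc∘ g)) (λ { (() , _) }))))
         (∑ᴵ²-zero (suc p) q n (λ f g → 𝟙-no (meetAt? zero zero (suc∘ f) (0∷ g)) (λ { (() , _) }))) ⟩
    (n C (p + q)) * ((p + q) C p) + 0 + 0
      ≡⟨ trans (+-identityʳ _) (trans (+-identityʳ _) (cong ((n C (p + q)) *_) (sym (*-identityˡ _)))) ⟩
    (n C (p + q)) * (1 * ((p + q) C p)) ∎
  head-step {suc p} {q} (suc i) zero = begin
    lower {suc p} {q} (suc i) zero + ∑ᴵ² (suc (suc p)) q n (λ f g → 𝟙 (meetAt? (suc i) zero (suc∘ f) (0∷ g)))
      ≡⟨ cong₂ _+_ (cong₂ _+_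
           (∑ᴵ²-zero (suc p) q n (λ f g → meetAt-00-suc f g {suc i} {zero} (λ { (() , _) })))
           (trans (∑ᴵ²-cong (suc p) (suc q) n (λ f g _ _ → meetAt-0+ f g i zero)) (#meetAt≡C i zero n)))
         (∑ᴵ²-zero (suc (suc p)) q n (λ f g → 𝟙-no (meetAt? (suc i) zero (suc∘ f) (0∷ g)) (λ { (() , _) }))) ⟩
    (n C suc (p + q)) * b {p} {q} i zero + 0
      ≡⟨ trans (+-identityʳ _) (cong (λ x → (n C suc (p + q)) * (x * ((p ∸ toℕ i + q) C (p ∸ toℕ i)))) (trans (C-self (toℕ i)) (sym (C-self (suc (toℕ i)))))) ⟩
    (n C suc (p + q)) * b {suc p} {q} (suc i) zero ∎
    where
    C-self : ∀ k → (k + 0) C k ≡ 1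
    C-self k = trans (cong (_C k) (+-identityʳ k)) (nCn≡1 k)
  head-step {p} {suc q} zero (suc j) = begin
    lower {p} {suc q} zero (suc j) + ∑ᴵ² (suc p) (suc q) n (λ f g → 𝟙 (meetAt? zero (suc j) (suc∘ f) (0∷ g)))
      ≡⟨ cong₂ _+_ (cong₂ _+_
           (∑ᴵ²-zero p (suc q) n (λ f g → meetAt-00-suc f g {zero} {suc j} (λ { (_ , ()) })))
           (∑ᴵ²-zero p (suc (suc q)) n (λ f g → 𝟙-no (meetAt? zero (suc j) (0∷ f) (suc∘ g)) (λ { (() , _) }))))
         (trans (∑ᴵ²-cong (suc p) (suc q) n (λ f g _ _ → meetAt-+0 f g zero j)) (#meetAt≡C zero j n)) ⟩
    (n C suc (p + q)) * b {p} {q} zero j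
      ≡⟨ cong (λ s → (n C s) * b {p} {q} zero j) (sym (+-suc p q)) ⟩
    (n C (p + suc q)) * b {p} {suc q} zero (suc j) ∎
  head-step {suc p} {suc q} (suc i) (suc j) = begin
    lower {suc p} {suc q} (suc i) (suc j) + ∑ᴵ² (suc (suc p)) (suc q) n (λ f g → 𝟙 (meetAt? (suc i) (suc j) (suc∘ f) (0∷ g)))
      ≡⟨ cong₂ _+_ (cong₂ _+_
           (∑ᴵ²-zero (suc p) (suc q) n (λ f g → meetAt-00-suc f g {suc i} {suc j} (λ { (() , _) })))
           (trans (∑ᴵ²-cong (suc p) (suc (suc q)) n (λ f g _ _ → meetAt-0+ f g i (suc j))) (#meetAt≡C i (suc j) n)))
         (trans (∑ᴵ²-cong (suc (suc p)) (suc q) n (λ f g _ _ → meetAt-+0 f g (suc i) j)) (#meetAt≡C (suc i) j n)) ⟩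
    (n C suc (p + suc q)) * (((toℕ i + suc (toℕ j)) C toℕ i) * c′) + (n C suc (suc p + q)) * (((suc (toℕ i) + toℕ j) C suc (toℕ i)) * c′)
      ≡⟨ cong₂ (λ s t → (n C suc (p + suc q)) * (((toℕ i + suc (toℕ j)) C toℕ i) * c′) + (n C suc s) * ((t C suc (toℕ i)) * c′))
           (sym (+-suc p q)) (sym (+-suc (toℕ i) (toℕ j))) ⟩
    (n C suc (p + suc q)) * (((toℕ i + suc (toℕ j)) C toℕ i) * c′) + (n C suc (p + suc q)) * (((toℕ i + suc (toℕ j)) C suc (toℕ i)) * c′)
      ≡⟨ collect (n C suc (p + suc q)) ((toℕ i + suc (toℕ j)) C toℕ i) ((toℕ i + suc (toℕ j)) C suc (toℕ i)) c′ ⟩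
    (n C suc (p + suc q)) * (((toℕ i + suc (toℕ j)) C toℕ i + (toℕ i + suc (toℕ j)) C suc (toℕ i)) * c′)
      ≡⟨ cong (λ x → (n C suc (p + suc q)) * (x * c′)) (nCk+nC[k+1]≡[n+1]C[k+1] (toℕ i + suc (toℕ j)) (toℕ i)) ⟩
    (n C suc (p + suc q)) * b {suc p} {suc q} (suc i) (suc j) ∎
    where
    c′ = ((p ∸ toℕ i) + (q ∸ toℕ j)) C (p ∸ toℕ i)
    collect : ∀ a x y z → a * (x * z) + a * (y * z) ≡ a * ((x + y) * z)
    collect = solve-∀

-- Pairs meeting at least twice

∑-bound : ∀ k {F : Fin k → ℕ} {c B} → (∀ i → c * F i ≤ B) → c * ∑[ i < k ] F i ≤ k * B
∑-bound k {F} {c} {B} le = begin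
  c * ∑[ i < k ] F i    ≡⟨ *-distribˡ-sum c F ⟩
  ∑[ i < k ] (c * F i)  ≤⟨ ∑-mono le ⟩
  ∑[ i < k ] B          ≡⟨ ∑-const k B ⟩
  k * B                 ∎
  where open ≤-Reasoning

-- The factor `c` on the left stands for a division of `B`; below it is `n * n`, the saving due to
-- two coincidences.
∑ᶠ-bound : ∀ m n {F : (Fin m → Fin n) → ℕ} {c B} → (∀ f → c * F f ≤ B) → c * ∑ᶠ m n F ≤ n ^ m * B
∑ᶠ-bound zero    n {B = B} le = ≤-trans (le (λ ())) (≤-reflexive (sym (*-identityˡ B)))
∑ᶠ-bound (suc m) n {c = c} {B} le = ≤-trans
  (∑-bound n {c = c} (λ a → ∑ᶠ-bound m n {c = c} (λ f → le (consF a f)))) (≤-reflexive (sym (*-assoc n (n ^ m) B)))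

∑ᶠ-∑-bound : ∀ m n k (F : (Fin m → Fin n) → Fin k → ℕ) {c B} →
  (∀ i → c * ∑ᶠ m n (λ f → F f i) ≤ B) → c * ∑ᶠ m n (λ f → ∑[ i < k ] F f i) ≤ k * B
∑ᶠ-∑-bound m n k F {c} le = ≤-trans (≤-reflexive (cong (c *_) (∑ᶠ-∑-comm m F))) (∑-bound k {c = c} le)

∑-fibre : ∀ {n} (x : Fin n) (y : ℕ) → ∑[ a < n ] (𝟙 (x ≟ a) * y) ≡ y
∑-fibre {n} x y = trans (sum-cong-≗ {n} (λ a → cong (_* y) (𝟙-⇔ (x ≟ a) (a ≟ x) sym sym))) (∑-δ x (λ _ → y))

∑ᶠ-one : ∀ m n → ∑ᶠ m n (λ _ → 1) ≡ n ^ m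
∑ᶠ-one zero    n = refl
∑ᶠ-one (suc m) n = trans (∑-const n _) (cong (n *_) (∑ᶠ-one m n))

-- One value is fixed and the others are free. The factor `n` on the left avoids the exponent m - 1.
∑ᶠ-hit : ∀ {m n} (j : Fin m) (x : Fin n) → n * ∑ᶠ m n (λ g → 𝟙 (x ≟ g j)) ≡ n ^ m
∑ᶠ-hit {suc m} {n} zero x = cong (n *_) (begin
  ∑[ a < n ] ∑ᶠ m n (λ g → 𝟙 (x ≟ a))      ≡⟨ sum-cong-≗ {n} (λ a → ∑ᶠ-cong m (λ g → sym (*-identityʳ (𝟙 (x ≟ a))))) ⟩
  ∑[ a < n ] ∑ᶠ m n (λ g → 𝟙 (x ≟ a) * 1)  ≡⟨ sum-cong-≗ {n} (λ a → trans (∑ᶠ-*ˡ m (𝟙 (x ≟ a)) (λ _ → 1)) (cong (𝟙 (x ≟ a) *_) (∑ᶠ-one m n))) ⟩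
  ∑[ a < n ] (𝟙 (x ≟ a) * n ^ m)           ≡⟨ ∑-fibre x (n ^ m) ⟩
  n ^ m                                     ∎)
  where open ≡-Reasoning
∑ᶠ-hit {suc m} {n} (suc j) x = cong (n *_) (trans (∑-const n _) (∑ᶠ-hit j x))

-- Distinct indices make the two constraints independent, so each accounts for one factor `n`.
∑ᶠ-hit₂ : ∀ {m n} {j j′ : Fin m} → j ≢ j′ → (x x′ : Fin n) → n * (n * ∑ᶠ m n (λ g → 𝟙 (x ≟ g j) * 𝟙 (x′ ≟ g j′))) ≡ n ^ m
∑ᶠ-hit₂ {suc m} {n} {zero}  {zero}   j≢j′ x x′ = contradiction refl j≢j′
∑ᶠ-hit₂ {suc m} {n} {zero}  {suc j′} j≢j′ x x′ = cong (n *_) (begin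
  n * ∑[ a < n ] ∑ᶠ m n (λ g → 𝟙 (x ≟ a) * 𝟙 (x′ ≟ g j′))
    ≡⟨ cong (n *_) (sum-cong-≗ {n} (λ a → ∑ᶠ-*ˡ m (𝟙 (x ≟ a)) (λ g → 𝟙 (x′ ≟ g j′)))) ⟩
  n * ∑[ a < n ] (𝟙 (x ≟ a) * ∑ᶠ m n (λ g → 𝟙 (x′ ≟ g j′)))
    ≡⟨ cong (n *_) (∑-fibre x _) ⟩
  n * ∑ᶠ m n (λ g → 𝟙 (x′ ≟ g j′))
    ≡⟨ ∑ᶠ-hit j′ x′ ⟩
  n ^ m ∎)
  where open ≡-Reasoning
∑ᶠ-hit₂ {suc m} {n} {suc j} {zero}   j≢j′ x x′ = trans
  (cong (λ s → n * (n * s)) (∑ᶠ-cong (suc m) {n} (λ g → *-comm (𝟙 (x ≟ g (suc j))) (𝟙 (x′ ≟ g zero)))))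
  (∑ᶠ-hit₂ {j = zero} {suc j} (λ ()) x′ x)
∑ᶠ-hit₂ {suc m} {n} {suc j} {suc j′} j≢j′ x x′ = cong (n *_) (trans (cong (n *_) (∑-const n _)) (∑ᶠ-hit₂ (j≢j′ ∘ cong suc) x x′))

term≤∑ : ∀ {n} (F : Fin n → ℕ) i → F i ≤ ∑[ j < n ] F j
term≤∑ F zero    = m≤m+n _ _
term≤∑ F (suc i) = ≤-trans (term≤∑ (F ∘ suc) i) (m≤n+m _ (F zero))

module _ {p q n : ℕ} (f : Fin p → Fin n) where

  coincidences : Fin p → Fin p → Fin q → Fin q → (Fin q → Fin n) → ℕ
  coincidences i i′ j j′ g = 𝟙 (¬? (j ≟ j′)) * (𝟙 (f i ≟ g j) * 𝟙 (f i′ ≟ g j′))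

  -- A union bound over the four indices that can witness a double meeting.
  meetTwice≤ : ∀ g → 𝟙 (meetTwice? f g) ≤ ∑[ i < p ] ∑[ i′ < p ] ∑[ j < q ] ∑[ j′ < q ] coincidences i i′ j j′ g
  meetTwice≤ g with meetTwice? f g
  ... | no _ = z≤n
  ... | yes (i , i′ , j , j′ , j≢j′ , eq , eq′) = begin
    1
      ≡⟨ sym (cong₂ _*_ (𝟙-yes (¬? (j ≟ j′)) j≢j′) (cong₂ _*_ (𝟙-yes (f i ≟ g j) eq) (𝟙-yes (f i′ ≟ g j′) eq′))) ⟩
    coincidences i i′ j j′ g
      ≤⟨ term≤∑ (λ j′ → coincidences i i′ j j′ g) j′ ⟩
    ∑[ j′ < q ] coincidences i i′ j j′ g
      ≤⟨ term≤∑ (λ j → ∑[ j′ < q ] coincidences i i′ j j′ g) j ⟩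
    ∑[ j < q ] ∑[ j′ < q ] coincidences i i′ j j′ g
      ≤⟨ term≤∑ (λ i′ → ∑[ j < q ] ∑[ j′ < q ] coincidences i i′ j j′ g) i′ ⟩
    ∑[ i′ < p ] ∑[ j < q ] ∑[ j′ < q ] coincidences i i′ j j′ g
      ≤⟨ term≤∑ (λ i → ∑[ i′ < p ] ∑[ j < q ] ∑[ j′ < q ] coincidences i i′ j j′ g) i ⟩
    ∑[ i < p ] ∑[ i′ < p ] ∑[ j < q ] ∑[ j′ < q ] coincidences i i′ j j′ g ∎
    where open ≤-Reasoning

  ∑ᶠ-coincidences : ∀ i i′ j j′ → n * n * ∑ᶠ q n (coincidences i i′ j j′) ≤ n ^ q
  ∑ᶠ-coincidences i i′ j j′ with j ≟ j′
  ... | yes _   = ≤-trans (≤-reflexive (trans (cong (n * n *_) (∑ᶠ-zero q {n} (λ g → refl))) (*-zeroʳ (n * n)))) z≤n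
  ... | no j≢j′ = ≤-reflexive (trans (*-assoc n n _) (trans
        (cong (λ s → n * (n * s)) (∑ᶠ-cong q {n} (λ g → *-identityˡ (𝟙 (f i ≟ g j) * 𝟙 (f i′ ≟ g j′)))))
        (∑ᶠ-hit₂ j≢j′ (f i) (f i′))))

-- Monotonicity is discarded and `f` is left free; for each `f` and each choice of the four indices,
-- two values of `g` are determined. Overcounting is harmless, since only the order of growth
-- matters.
#meetTwice-bound : ∀ p q n → n * n * #meetTwice p q n ≤ n ^ p * (p * (p * (q * (q * n ^ q))))
#meetTwice-bound p q n = ≤-trans
  (*-monoʳ-≤ (n * n) (≤-trans (∑ᴵ-mono p (λ f → ∑ᴵ≤∑ᶠ q (λ g → 𝟙 (meetTwice? f g)))) (∑ᴵ≤∑ᶠ p (λ f → ∑ᶠ q n (λ g → 𝟙 (meetTwice? f g))))))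
  (∑ᶠ-bound p n {λ f → ∑ᶠ q n (λ g → 𝟙 (meetTwice? f g))} {n * n} (λ f → ≤-trans
    (*-monoʳ-≤ (n * n) (∑ᶠ-mono q {n} (meetTwice≤ f)))
    (∑ᶠ-∑-bound q n p (λ g i → ∑[ i′ < p ] ∑[ j < q ] ∑[ j′ < q ] coincidences f i i′ j j′ g) {n * n} (λ i →
      ∑ᶠ-∑-bound q n p (λ g i′ → ∑[ j < q ] ∑[ j′ < q ] coincidences f i i′ j j′ g) {n * n} (λ i′ →
        ∑ᶠ-∑-bound q n q (λ g j → ∑[ j′ < q ] coincidences f i i′ j j′ g) {n * n} (λ j →
          ∑ᶠ-∑-bound q n q (λ g j′ → coincidences f i i′ j j′ g) {n * n} (∑ᶠ-coincidences f i i′ j)))))))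

-- Falling factorials and their leading terms

P′*!≡! : ∀ {n} k d → k + d ≡ n → (n P′ k) * d ! ≡ n !
P′*!≡! zero    d refl = *-identityˡ (d !)
P′*!≡! {n} (suc k) d eq = begin
  (n ∸ k) * (n P′ k) * d !  ≡⟨ cong (λ x → x * (n P′ k) * d !) (trans (cong (_∸ k) k+1+d) (m+n∸m≡n k (suc d))) ⟩
  suc d * (n P′ k) * d !    ≡⟨ rotate (suc d) (n P′ k) (d !) ⟩
  (n P′ k) * suc d !        ≡⟨ P′*!≡! k (suc d) (sym k+1+d) ⟩
  n !                       ∎
  where
  open ≡-Reasoning
  k+1+d : n ≡ k + suc d
  k+1+d = trans (sym eq) (sym (+-suc k d))
  rotate : ∀ a b c → a * b * c ≡ b * (a * c)
  rotate = solve-∀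

C*!*!≡! : ∀ k d → ((k + d) C k) * (k ! * d !) ≡ (k + d) !
C*!*!≡! k d = begin
  ((k + d) C k) * (k ! * d !)
    ≡⟨ cong (λ x → ((k + d) C k) * (k ! * x !)) (sym (m+n∸m≡n k d)) ⟩
  ((k + d) C k) * (k ! * (k + d ∸ k) !)
    ≡⟨ cong (_* (k ! * (k + d ∸ k) !)) (nCk≡n!/k![n-k]! (m≤m+n k d)) ⟩
  (k + d) ! / (k ! * (k + d ∸ k) !) * (k ! * (k + d ∸ k) !)
    ≡⟨ m/n*n≡m (k![n∸k]!∣n! (m≤m+n k d)) ⟩
  (k + d) ! ∎
  where
  open ≡-Reasoning
  instance _ = k !* (k + d ∸ k) !≢0

C*!≡P′ : ∀ {n} k d → k + d ≡ n → (n C k) * k ! ≡ n P′ k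
C*!≡P′ k d refl = *-cancelʳ-≡ _ _ (d !) {{d !≢0}} (trans (*-assoc ((k + d) C k) (k !) (d !)) (trans (C*!*!≡! k d) (sym (P′*!≡! k d refl))))

-- The defect of multiplicativity of falling factorials, generated by n ∸ k = m + (n ∸ (m + k)).
gap : ℕ → ℕ → ℕ → ℕ
gap n m zero    = 0
gap n m (suc k) = (n ∸ k) * gap n m k + m * (n P′ (m + k))

P′*P′ : ∀ n m k → m + k ≤ n → (n P′ m) * (n P′ k) ≡ n P′ (m + k) + gap n m k
P′*P′ n m zero    _ = trans (*-identityʳ _) (trans (cong (n P′_) (sym (+-identityʳ m))) (sym (+-identityʳ _)))
P′*P′ n m (suc k) le = begin
  (n P′ m) * ((n ∸ k) * (n P′ k))
    ≡⟨ swap (n P′ m) (n ∸ k) (n P′ k) ⟩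
  (n ∸ k) * ((n P′ m) * (n P′ k))
    ≡⟨ cong ((n ∸ k) *_) (P′*P′ n m k m+k≤n) ⟩
  (n ∸ k) * (n P′ (m + k) + gap n m k)
    ≡⟨ *-distribˡ-+ (n ∸ k) (n P′ (m + k)) (gap n m k) ⟩
  (n ∸ k) * (n P′ (m + k)) + (n ∸ k) * gap n m k
    ≡⟨ cong (λ x → x * (n P′ (m + k)) + (n ∸ k) * gap n m k) n∸k ⟩
  (m + (n ∸ (m + k))) * (n P′ (m + k)) + (n ∸ k) * gap n m k
    ≡⟨ collect m (n ∸ (m + k)) (n P′ (m + k)) ((n ∸ k) * gap n m k) ⟩
  (n ∸ (m + k)) * (n P′ (m + k)) + gap n m (suc k)
    ≡⟨ cong (λ x → n P′ x + gap n m (suc k)) (sym (+-suc m k)) ⟩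
  n P′ (m + suc k) + gap n m (suc k) ∎
  where
  open ≡-Reasoning
  m+k≤n : m + k ≤ n
  m+k≤n = ≤-trans (+-monoʳ-≤ m (n≤1+n k)) le
  n∸k : n ∸ k ≡ m + (n ∸ (m + k))
  n∸k = trans (sym (m+[n∸m]≡n (m+n≤o⇒m≤o∸n m m+k≤n)))
    (cong (m +_) (trans (∸-+-assoc n k m) (cong (n ∸_) (+-comm k m))))
  swap : ∀ a b c → a * (b * c) ≡ b * (a * c)
  swap = solve-∀
  collect : ∀ a b x y → (a + b) * x + y ≡ b * x + (y + a * x)
  collect = solve-∀

-- u n = α n^(e+1) + O(n^e)
record Leads (u : ℕ → ℕ) (α e : ℕ) : Set where
  constructor leads
  field
    error  : ℕ
    bounds : ∀ n → 1 ≤ n → (u n ≤ α * n ^ suc e + error * n ^ e) × (α * n ^ suc e ≤ u n + error * n ^ e)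

leads-+ : ∀ {u v α β e} → Leads u α e → Leads v β e → Leads (λ n → u n + v n) (α + β) e
leads-+ {u} {v} {α} {β} {e} (leads K hu) (leads L hv) = leads (K + L) λ n 1≤n →
  ≤-trans (+-mono-≤ (proj₁ (hu n 1≤n)) (proj₁ (hv n 1≤n)))
    (≤-reflexive (upper α β K L (n ^ suc e) (n ^ e))) ,
  ≤-trans (≤-reflexive (*-distribʳ-+ (n ^ suc e) α β))
    (≤-trans (+-mono-≤ (proj₂ (hu n 1≤n)) (proj₂ (hv n 1≤n))) (≤-reflexive (lower (u n) (v n) K L (n ^ e))))
  where
  upper : ∀ α β K L x y → α * x + K * y + (β * x + L * y) ≡ (α + β) * x + (K + L) * y
  upper = solve-∀
  lower : ∀ u v K L y → u + K * y + (v + L * y) ≡ u + v + (K + L) * y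
  lower = solve-∀

leads-* : ∀ c {u α e} → Leads u α e → Leads (λ n → c * u n) (c * α) e
leads-* c {u} {α} {e} (leads K hu) = leads (c * K) λ n 1≤n →
  ≤-trans (*-monoʳ-≤ c (proj₁ (hu n 1≤n))) (≤-reflexive (expand c α K (n ^ suc e) (n ^ e))) ,
  ≤-trans (≤-reflexive (*-assoc c α (n ^ suc e)))
    (≤-trans (*-monoʳ-≤ c (proj₂ (hu n 1≤n))) (≤-reflexive (trans (*-distribˡ-+ c (u n) _) (cong (c * u n +_) (sym (*-assoc c K (n ^ e)))))))
  where
  expand : ∀ c α K x y → c * (α * x + K * y) ≡ c * α * x + c * K * y
  expand = solve-∀

-- The upper bound replaces `n ∸ k` by `n`. For the lower bound `n` is at most `(n ∸ k) + k`, and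
-- the surplus `k * u n` is at most `k * (α + K)` times the next lower power, by the upper bound for
-- `u` and `1 ≤ n`. This gives the error constant and also covers n below `k`, where the subtraction
-- truncates.
leads-∸ : ∀ k {u α e} → Leads u α e → Leads (λ n → (n ∸ k) * u n) α (suc e)
leads-∸ k {u} {α} {e} (leads K hu) = leads (K + k * (α + K)) λ n 1≤n →
  (begin
    (n ∸ k) * u n                                        ≤⟨ *-mono-≤ (m∸n≤m n k) (proj₁ (hu n 1≤n)) ⟩
    n * (α * n ^ suc e + K * n ^ e)                      ≡⟨ expand n α K (n ^ suc e) (n ^ e) ⟩
    α * n ^ suc (suc e) + K * n ^ suc e                  ≤⟨ +-monoʳ-≤ (α * n ^ suc (suc e)) (*-monoˡ-≤ (n ^ suc e) (m≤m+n K _)) ⟩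
    α * n ^ suc (suc e) + (K + k * (α + K)) * n ^ suc e  ∎) ,
  (begin
    α * n ^ suc (suc e)                                                ≡⟨ rotate α n (n ^ suc e) ⟩
    n * (α * n ^ suc e)                                                ≤⟨ *-monoʳ-≤ n (proj₂ (hu n 1≤n)) ⟩
    n * (u n + K * n ^ e)                                              ≡⟨ distribute n (u n) K (n ^ e) ⟩
    n * u n + K * n ^ suc e                                            ≤⟨ +-monoˡ-≤ (K * n ^ suc e) (*-monoˡ-≤ (u n) (≤-trans (m≤n+m∸n n k) (≤-reflexive (+-comm k (n ∸ k))))) ⟩
    (n ∸ k + k) * u n + K * n ^ suc e                                  ≡⟨ cong (_+ K * n ^ suc e) (*-distribʳ-+ (u n) (n ∸ k) k) ⟩
    (n ∸ k) * u n + k * u n + K * n ^ suc e                            ≤⟨ +-monoˡ-≤ (K * n ^ suc e) (+-monoʳ-≤ ((n ∸ k) * u n) (*-monoʳ-≤ k (proj₁ (hu n 1≤n)))) ⟩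
    (n ∸ k) * u n + k * (α * n ^ suc e + K * n ^ e) + K * n ^ suc e    ≤⟨ +-monoˡ-≤ (K * n ^ suc e) (+-monoʳ-≤ ((n ∸ k) * u n) (*-monoʳ-≤ k (+-monoʳ-≤ (α * n ^ suc e) (*-monoʳ-≤ K (n^e≤ n 1≤n))))) ⟩
    (n ∸ k) * u n + k * (α * n ^ suc e + K * n ^ suc e) + K * n ^ suc e ≡⟨ collect ((n ∸ k) * u n) k α K (n ^ suc e) ⟩
    (n ∸ k) * u n + (K + k * (α + K)) * n ^ suc e                      ∎)
  where
  open ≤-Reasoning
  n^e≤ : ∀ n → 1 ≤ n → n ^ e ≤ n ^ suc e
  n^e≤ n 1≤n = ≤-trans (≤-reflexive (sym (*-identityˡ (n ^ e)))) (*-monoˡ-≤ (n ^ e) 1≤n)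
  expand : ∀ n α K x y → n * (α * x + K * y) ≡ α * (n * x) + K * (n * y)
  expand = solve-∀
  rotate : ∀ α n x → α * (n * x) ≡ n * (α * x)
  rotate = solve-∀
  distribute : ∀ n u K y → n * (u + K * y) ≡ n * u + K * (n * y)
  distribute = solve-∀
  collect : ∀ w k α K x → w + k * (α * x + K * x) + K * x ≡ w + (K + k * (α + K)) * x
  collect = solve-∀

leads-P′ : ∀ k → Leads (_P′ suc k) 1 k
leads-P′ zero    = leads 0 λ n _ → ≤-reflexive (upper n) , ≤-reflexive (lower n)
  where
  upper : ∀ n → n * 1 ≡ 1 * (n * 1) + 0
  upper = solve-∀
  lower : ∀ n → 1 * (n * 1) ≡ n * 1 + 0
  lower = solve-∀
leads-P′ (suc k) = leads-∸ (suc k) (leads-P′ k)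

-- Each step of the recursion raises the degree of the old gap by one, keeping its coefficient, and
-- adds `suc m` times a falling factorial of the same new degree. After `suc k` steps the
-- coefficients add up to the product.
leads-gap : ∀ m k → Leads (λ n → gap n (suc m) (suc k)) (suc m * suc k) (m + k)
leads-gap m zero    = subst₂ (Leads (λ n → gap n (suc m) 1)) (zero-first (suc m)) refl
  (leads-+ {λ n → n * 0} {α = 0} (leads 0 λ n _ → ≤-reflexive (*-zeroʳ n) , z≤n) (leads-* (suc m) (leads-P′ (m + 0))))
  where
  zero-first : ∀ a → 0 + a * 1 ≡ a * 1
  zero-first = solve-∀
leads-gap m (suc k) = subst₂ (Leads (λ n → gap n (suc m) (suc (suc k)))) (next (suc m) (suc k)) (sym (+-suc m k))
  (leads-+ (leads-∸ (suc k) (leads-gap m k))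
    (leads-* (suc m) (subst (λ s → Leads (_P′ suc s) 1 (suc (m + k))) (sym (+-suc m k)) (leads-P′ (suc (m + k))))))
  where
  next : ∀ a b → a * b + a * 1 ≡ a * suc b
  next = solve-∀

-- The trace, and closed forms of the moments

P≡𝟙 : ∀ {m} (π : Permutation′ m) i j → P π i j ≡ 𝟙 (j ≟ (π ⟨$⟩ʳ i))
P≡𝟙 π i j = ⟦⟧≡𝟙 (toℕ (π ⟨$⟩ʳ i) ≡ᵇ toℕ j) (j ≟ (π ⟨$⟩ʳ i))
  (λ t → sym (toℕ-injective (≡ᵇ⇒≡ _ _ t))) (λ eq → ≡⇒≡ᵇ _ _ (cong toℕ (sym eq)))

P⊗ : ∀ {m} (π : Permutation′ m) M i j → (P π ⊗ M) i j ≡ M (π ⟨$⟩ʳ i) j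
P⊗ {m} π M i j = trans (sum-allFin m _)
  (trans (sum-cong-≗ {m} (λ l → cong (_* M l j) (P≡𝟙 π i l))) (∑-δ (π ⟨$⟩ʳ i) (λ l → M l j)))

⊗Pinv : ∀ {m} (π : Permutation′ m) M i j → (M ⊗ Pinv π) i j ≡ M i (π ⟨$⟩ʳ j)
⊗Pinv {m} π M i j = trans (sum-allFin m _) (trans
  (sum-cong-≗ {m} (λ l → trans (*-comm (M i l) _) (cong (_* M i l) (trans (P≡𝟙 (flip π) l j)
    (𝟙-⇔ (j ≟ (π ⟨$⟩ˡ l)) (l ≟ (π ⟨$⟩ʳ j)) (λ { refl → sym (inverseʳ π) }) (λ { refl → sym (inverseˡ π) }))))))
  (∑-δ (π ⟨$⟩ʳ j) (M i)))

C-sym : ∀ a b → (a + b) C a ≡ (b + a) C b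
C-sym a b = trans (nCk≡nC[n∸k] (m≤m+n a b)) (cong₂ _C_ (+-comm a b) (m+n∸m≡n a b))

-- The trace delivers its first bracket with the arguments exchanged, and this puts them back in
-- order.
bracket-sym : ∀ m i j → bracket m i j ≡ bracket m j i
bracket-sym m i j = cong₂ _*_ (C-sym (toℕ i) (toℕ j)) (C-sym (m ∸ 1 ∸ toℕ i) (m ∸ 1 ∸ toℕ j))

module _ {m : ℕ} (π₁ π₂ : Permutation′ m) where

  bracketSum≡∑ : bracketSum π₁ π₂ ≡ ∑[ i < m ] ∑[ j < m ] (bracket m i j * bracket m (π₁ ⟨$⟩ʳ i) (π₂ ⟨$⟩ʳ j))
  bracketSum≡∑ = begin
    sumᴸ (concatMap row (allFin m))
      ≡⟨ cong sumᴸ (sym (map-id (concatMap row (allFin m)))) ⟩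
    sumᴸ (map id (concatMap row (allFin m)))
      ≡⟨ sum-map-concatMap id row (allFin m) ⟩
    sumᴸ (map (λ i → sumᴸ (map id (row i))) (allFin m))
      ≡⟨ sum-allFin m (λ i → sumᴸ (map id (row i))) ⟩
    ∑[ i < m ] sumᴸ (map id (row i))
      ≡⟨ sum-cong-≗ {m} (λ i → trans (cong sumᴸ (map-id (row i))) (sum-allFin m _)) ⟩
    ∑[ i < m ] ∑[ j < m ] (bracket m i j * bracket m (π₁ ⟨$⟩ʳ i) (π₂ ⟨$⟩ʳ j)) ∎
    where
    open ≡-Reasoning
    row : Fin m → List ℕ
    row i = map (λ j → bracket m i j * bracket m (π₁ ⟨$⟩ʳ i) (π₂ ⟨$⟩ʳ j)) (allFin m)

  trace≡bracketSum : Tr (A m ⊗ (P π₁ ⊗ (A m ⊗ Pinv π₂))) ≡ bracketSum π₁ π₂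
  trace≡bracketSum = begin
    Tr (A m ⊗ (P π₁ ⊗ (A m ⊗ Pinv π₂)))
      ≡⟨ sum-allFin m _ ⟩
    ∑[ j < m ] (A m ⊗ (P π₁ ⊗ (A m ⊗ Pinv π₂))) j j
      ≡⟨ sum-cong-≗ {m} (λ j → sum-allFin m _) ⟩
    ∑[ j < m ] ∑[ i < m ] (A m j i * (P π₁ ⊗ (A m ⊗ Pinv π₂)) i j)
      ≡⟨ sum-cong-≗ {m} (λ j → sum-cong-≗ {m} (λ i → cong₂ _*_ (bracket-sym m j i)
           (trans (P⊗ π₁ (A m ⊗ Pinv π₂) i j) (⊗Pinv π₂ (A m) (π₁ ⟨$⟩ʳ i) j)))) ⟩
    ∑[ j < m ] ∑[ i < m ] (bracket m i j * bracket m (π₁ ⟨$⟩ʳ i) (π₂ ⟨$⟩ʳ j))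
      ≡⟨ ∑-comm (λ j i → bracket m i j * bracket m (π₁ ⟨$⟩ʳ i) (π₂ ⟨$⟩ʳ j)) ⟩
    ∑[ i < m ] ∑[ j < m ] (bracket m i j * bracket m (π₁ ⟨$⟩ʳ i) (π₂ ⟨$⟩ʳ j))
      ≡⟨ sym bracketSum≡∑ ⟩
    bracketSum π₁ π₂ ∎
    where open ≡-Reasoning

-- The mean of `X π` is `n P′ m` over (m!)², stated with both denominators cleared.
sum-X-closed : ∀ {m n} d → m + d ≡ n → (π : Permutation′ m) →
               ∑ˢ n (X π) * (m ! * m !) ≡ (n P′ m) * n !
sum-X-closed {m} {n} d m+d≡n π = begin
  ∑ˢ n (X π) * (m ! * m !)
    ≡⟨ cong (_* (m ! * m !)) (trans (sum-X d m+d≡n π) (cong (λ x → x * (x * d !)) (#increasing≡C m n))) ⟩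
  (n C m) * ((n C m) * d !) * (m ! * m !)
    ≡⟨ regroup (n C m) (m !) (d !) ⟩
  (n C m) * m ! * ((n C m) * m ! * d !)
    ≡⟨ cong₂ (λ x y → x * (y * d !)) (C*!≡P′ m d m+d≡n) (C*!≡P′ m d m+d≡n) ⟩
  (n P′ m) * ((n P′ m) * d !)
    ≡⟨ cong ((n P′ m) *_) (P′*!≡! m d m+d≡n) ⟩
  (n P′ m) * n ! ∎
  where
  open ≡-Reasoning
  regroup : ∀ c a x → c * (c * x) * (a * a) ≡ c * a * (c * a * x)
  regroup = solve-∀

module _ {k n : ℕ} (π₁ π₂ : Permutation′ (suc k)) (d : ℕ) (2m+d≡n : suc k + suc k + d ≡ n) where

  private
    m e : ℕ
    m = suc k
    e = suc (k + k)

    e+1+d≡n : e + suc d ≡ n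
    e+1+d≡n = trans (shift k d) 2m+d≡n
      where
      shift : ∀ k d → suc (k + k) + suc d ≡ suc k + suc k + d
      shift = solve-∀

  disjointPart meetPart : ℕ
  disjointPart = #disjoint m m n * (#disjoint m m n * d !)
  meetPart = ∑[ i < m ] ∑[ j < m ] (#meetAt i j n * (#meetAt (π₁ ⟨$⟩ʳ i) (π₂ ⟨$⟩ʳ j) n * suc d !))

  -- The number of disjoint pairs times (m!)² is `n P′ (m + m)`. One of its two occurrences absorbs
  -- `d !` to become the `n !` that the expectation divides out.
  disjointPart-closed : disjointPart * (m ! * m ! * (m ! * m !)) ≡ (n P′ (m + m)) * n !
  disjointPart-closed = begin
    #disjoint m m n * (#disjoint m m n * d !) * (m ! * m ! * (m ! * m !))
      ≡⟨ regroup (#disjoint m m n) (d !) (m ! * m !) ⟩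
    #disjoint m m n * (m ! * m !) * (#disjoint m m n * (m ! * m !) * d !)
      ≡⟨ cong (λ x → x * (x * d !)) #disjoint-P′ ⟩
    (n P′ (m + m)) * ((n P′ (m + m)) * d !)
      ≡⟨ cong ((n P′ (m + m)) *_) (P′*!≡! (m + m) d 2m+d≡n) ⟩
    (n P′ (m + m)) * n ! ∎
    where
    open ≡-Reasoning
    regroup : ∀ c x a → c * (c * x) * (a * a) ≡ c * a * (c * a * x)
    regroup = solve-∀
    #disjoint-P′ : #disjoint m m n * (m ! * m !) ≡ n P′ (m + m)
    #disjoint-P′ = begin
      #disjoint m m n * (m ! * m !)                      ≡⟨ cong (_* (m ! * m !)) (#disjoint≡C m m n) ⟩
      (n C (m + m)) * ((m + m) C m) * (m ! * m !)        ≡⟨ *-assoc (n C (m + m)) ((m + m) C m) _ ⟩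
      (n C (m + m)) * (((m + m) C m) * (m ! * m !))      ≡⟨ cong ((n C (m + m)) *_) (C*!*!≡! m m) ⟩
      (n C (m + m)) * (m + m) !                          ≡⟨ C*!≡P′ (m + m) d 2m+d≡n ⟩
      n P′ (m + m)                                       ∎

  -- The factor `n C e` is common to all meeting indices, once for positions and once for values, so
  -- only the products of brackets remain under the sum.
  meetPart-closed : meetPart * (e ! * e !) ≡ bracketSum π₁ π₂ * (n P′ e) * n !
  meetPart-closed = begin
    meetPart * (e ! * e !)
      ≡⟨ cong (_* (e ! * e !)) (sum-cong-≗ {m} (λ i → sum-cong-≗ {m} (λ j → term i j))) ⟩
    (∑[ i < m ] ∑[ j < m ] (bb i j * y)) * (e ! * e !)
      ≡⟨ cong (_* (e ! * e !)) (trans (sum-cong-≗ {m} (λ i → sym (*-distribʳ-sum y (bb i)))) (sym (*-distribʳ-sum y (λ i → ∑[ j < m ] bb i j)))) ⟩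
    (∑[ i < m ] ∑[ j < m ] bb i j) * y * (e ! * e !)
      ≡⟨ cong (λ x → x * y * (e ! * e !)) (sym (bracketSum≡∑ π₁ π₂)) ⟩
    bracketSum π₁ π₂ * ((n C e) * ((n C e) * suc d !)) * (e ! * e !)
      ≡⟨ regroup (bracketSum π₁ π₂) (n C e) (suc d !) (e !) ⟩
    bracketSum π₁ π₂ * ((n C e) * e !) * ((n C e) * e ! * suc d !)
      ≡⟨ cong (λ x → bracketSum π₁ π₂ * x * (x * suc d !)) (C*!≡P′ e (suc d) e+1+d≡n) ⟩
    bracketSum π₁ π₂ * (n P′ e) * ((n P′ e) * suc d !)
      ≡⟨ cong (bracketSum π₁ π₂ * (n P′ e) *_) (P′*!≡! e (suc d) e+1+d≡n) ⟩
    bracketSum π₁ π₂ * (n P′ e) * n ! ∎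
    where
    open ≡-Reasoning
    y : ℕ
    y = (n C e) * ((n C e) * suc d !)
    bb : Fin m → Fin m → ℕ
    bb i j = bracket m i j * bracket m (π₁ ⟨$⟩ʳ i) (π₂ ⟨$⟩ʳ j)
    rearrange : ∀ c b b′ x → c * b * (c * b′ * x) ≡ b * b′ * (c * (c * x))
    rearrange = solve-∀
    term : ∀ i j → #meetAt i j n * (#meetAt (π₁ ⟨$⟩ʳ i) (π₂ ⟨$⟩ʳ j) n * suc d !) ≡ bb i j * y
    term i j = trans
      (cong₂ (λ u v → u * (v * suc d !)) (#meetAt≡C i j n) (#meetAt≡C (π₁ ⟨$⟩ʳ i) (π₂ ⟨$⟩ʳ j) n))
      (rearrange (n C e) (bracket m i j) (bracket m (π₁ ⟨$⟩ʳ i) (π₂ ⟨$⟩ʳ j)) (suc d !))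
    regroup : ∀ b c x w → b * (c * (c * x)) * (w * w) ≡ b * (c * w) * (c * w * x)
    regroup = solve-∀

-- Fractions

toℚᵘ-/ : ∀ i e → ℚ.toℚᵘ (i ℚ./ suc e) ℚᵘ.≃ ℚᵘ.mkℚᵘ i e
toℚᵘ-/ i e = ℚ.toℚᵘ-fromℚᵘ (ℚᵘ.mkℚᵘ i e)

module _ (x y e f : ℕ) .{{_ : NonZero e}} .{{_ : NonZero f}} where

  /-cross : x * f ≡ y * e → (ℤ.+ x) ℚ./ e ≡ (ℤ.+ y) ℚ./ f
  /-cross eq = go e f eq
    where
    go : ∀ e f .{{_ : NonZero e}} .{{_ : NonZero f}} → x * f ≡ y * e → (ℤ.+ x) ℚ./ e ≡ (ℤ.+ y) ℚ./ f
    go (suc e) (suc f) eq = ℚ.fromℚᵘ-cong {ℚᵘ.mkℚᵘ (ℤ.+ x) e} {ℚᵘ.mkℚᵘ (ℤ.+ y) f}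
      (ℚᵘ.*≡* (trans (sym (ℤ.pos-* x (suc f))) (trans (cong ℤ.+_ eq) (ℤ.pos-* y (suc e)))))

  /-cross-≤ : x * f ≤ y * e → (ℤ.+ x) ℚ./ e ℚ.≤ (ℤ.+ y) ℚ./ f
  /-cross-≤ le = go e f le
    where
    go : ∀ e f .{{_ : NonZero e}} .{{_ : NonZero f}} → x * f ≤ y * e → (ℤ.+ x) ℚ./ e ℚ.≤ (ℤ.+ y) ℚ./ f
    go (suc e) (suc f) le = ℚ.toℚᵘ-cancel-≤ (ℚᵘ.≤-respˡ-≃ (ℚᵘ.≃-sym (toℚᵘ-/ (ℤ.+ x) e)) (ℚᵘ.≤-respʳ-≃ (ℚᵘ.≃-sym (toℚᵘ-/ (ℤ.+ y) f))
      (ℚᵘ.*≤* (subst₂ ℤ._≤_ (ℤ.pos-* x (suc f)) (ℤ.pos-* y (suc e)) (ℤ.+≤+ le)))))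

/-+ : ∀ i j e .{{_ : NonZero e}} → (i ℤ.+ j) ℚ./ e ≡ i ℚ./ e ℚ.+ j ℚ./ e
/-+ i j (suc e) = ℚ.toℚᵘ-injective (begin
  ℚ.toℚᵘ ((i ℤ.+ j) ℚ./ suc e)                      ≈⟨ toℚᵘ-/ (i ℤ.+ j) e ⟩
  ℚᵘ.mkℚᵘ (i ℤ.+ j) e                               ≈⟨ ℚᵘ.*≡* (crossed i j (ℤ.+ suc e)) ⟩
  ℚᵘ.mkℚᵘ i e ℚᵘ.+ ℚᵘ.mkℚᵘ j e                      ≈⟨ ℚᵘ.+-cong (toℚᵘ-/ i e) (toℚᵘ-/ j e) ⟨
  ℚ.toℚᵘ (i ℚ./ suc e) ℚᵘ.+ ℚ.toℚᵘ (j ℚ./ suc e)    ≈⟨ ℚ.toℚᵘ-homo-+ (i ℚ./ suc e) (j ℚ./ suc e) ⟨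
  ℚ.toℚᵘ (i ℚ./ suc e ℚ.+ j ℚ./ suc e)              ∎)
  where
  open import Relation.Binary.Reasoning.Setoid ℚᵘ.≃-setoid
  crossed : ∀ i j s → (i ℤ.+ j) ℤ.* (s ℤ.* s) ≡ (i ℤ.* s ℤ.+ j ℤ.* s) ℤ.* s
  crossed = ℤ-Ring.solve-∀

/-* : ∀ i j e f .{{_ : NonZero e}} .{{_ : NonZero f}} →
      (i ℚ./ e) ℚ.* (j ℚ./ f) ≡ ((i ℤ.* j) ℚ./ (e * f)) {{m*n≢0 e f}}
/-* i j (suc e) (suc f) = ℚ.toℚᵘ-injective (begin
  ℚ.toℚᵘ ((i ℚ./ suc e) ℚ.* (j ℚ./ suc f))              ≈⟨ ℚ.toℚᵘ-homo-* (i ℚ./ suc e) (j ℚ./ suc f) ⟩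
  ℚ.toℚᵘ (i ℚ./ suc e) ℚᵘ.* ℚ.toℚᵘ (j ℚ./ suc f)    ≈⟨ ℚᵘ.*-cong (toℚᵘ-/ i e) (toℚᵘ-/ j f) ⟩
  ℚᵘ.mkℚᵘ i e ℚᵘ.* ℚᵘ.mkℚᵘ j f                      ≈⟨ toℚᵘ-/ (i ℤ.* j) _ ⟨
  ℚ.toℚᵘ ((i ℤ.* j) ℚ./ (suc e * suc f))            ∎)
  where open import Relation.Binary.Reasoning.Setoid ℚᵘ.≃-setoid

/-− : ∀ i j e .{{_ : NonZero e}} → (i ℤ.- j) ℚ./ e ≡ i ℚ./ e ℚ.- j ℚ./ e
/-− i j e = begin
  (i ℤ.- j) ℚ./ e                                ≡⟨ add-sub ((i ℤ.- j) ℚ./ e) (j ℚ./ e) ⟩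
  ((i ℤ.- j) ℚ./ e ℚ.+ j ℚ./ e) ℚ.- j ℚ./ e      ≡⟨ cong (ℚ._- j ℚ./ e) (sym (/-+ (i ℤ.- j) j e)) ⟩
  ((i ℤ.- j) ℤ.+ j) ℚ./ e ℚ.- j ℚ./ e            ≡⟨ cong (λ x → x ℚ./ e ℚ.- j ℚ./ e) (sub-add i j) ⟩
  i ℚ./ e ℚ.- j ℚ./ e                            ∎
  where
  open ≡-Reasoning
  open ℚ-Solver.+-*-Solver using (solve; _:+_; _:-_; _:=_)
  add-sub : ∀ p q → p ≡ (p ℚ.+ q) ℚ.- q
  add-sub = solve 2 (λ p q → p := (p :+ q) :- q) refl
  sub-add : ∀ i j → (i ℤ.- j) ℤ.+ j ≡ i
  sub-add = ℤ-Ring.solve-∀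

ℕ→ℚ-+ : ∀ x y → ℕ→ℚ (x + y) ≡ ℕ→ℚ x ℚ.+ ℕ→ℚ y
ℕ→ℚ-+ x y = trans (cong (ℚ._/ 1) (ℤ.pos-+ x y)) (/-+ (ℤ.+ x) (ℤ.+ y) 1)

ℕ→ℚ-* : ∀ x y → ℕ→ℚ (x * y) ≡ ℕ→ℚ x ℚ.* ℕ→ℚ y
ℕ→ℚ-* x y = trans (cong (ℚ._/ 1) (ℤ.pos-* x y)) (sym (/-* (ℤ.+ x) (ℤ.+ y) 1 1))

p≤q+r⇒p-q≤r : ∀ p q r → p ℚ.≤ q ℚ.+ r → p ℚ.- q ℚ.≤ r
p≤q+r⇒p-q≤r p q r le = ℚ.≤-trans (ℚ.+-monoˡ-≤ (ℚ.- q) le) (ℚ.≤-reflexive (cancel q r))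
  where
  open ℚ-Solver.+-*-Solver using (solve; _:+_; _:-_; _:=_)
  cancel : ∀ q r → (q ℚ.+ r) ℚ.- q ≡ r
  cancel = solve 2 (λ q r → (q :+ r) :- q := r) refl

∣p-q∣≤ : ∀ {p q r} → p ℚ.≤ q ℚ.+ r → q ℚ.≤ p ℚ.+ r → ℚ.∣ p ℚ.- q ∣ ℚ.≤ r
∣p-q∣≤ {p} {q} {r} p≤q+r q≤p+r with ℚ.∣p∣≡p∨∣p∣≡-p (p ℚ.- q)
... | inj₁ eq = ℚ.≤-trans (ℚ.≤-reflexive eq) (p≤q+r⇒p-q≤r p q r p≤q+r)
... | inj₂ eq = ℚ.≤-trans (ℚ.≤-reflexive (trans eq (flip-sub p q))) (p≤q+r⇒p-q≤r q p r q≤p+r)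
  where
  open ℚ-Solver.+-*-Solver using (solve; _:-_; :-_; _:=_)
  flip-sub : ∀ p q → ℚ.- (p ℚ.- q) ≡ q ℚ.- p
  flip-sub = solve 2 (λ p q → :- (p :- q) := q :- p) refl

-- Division by `e`, which is at least one, can only shrink the error, so the bound on the numerators
-- is kept undivided.
/-difference : ∀ x y {t} e .{{_ : NonZero e}} → x ≤ y + t → y ≤ x + t →
               ℚ.∣ (ℤ.+ x) ℚ./ e ℚ.- (ℤ.+ y) ℚ./ e ∣ ℚ.≤ ℕ→ℚ t
/-difference x y {t} e x≤y+t y≤x+t = ∣p-q∣≤ (half x y x≤y+t) (half y x y≤x+t)
  where
  open ℚ.≤-Reasoning
  half : ∀ x y → x ≤ y + t → (ℤ.+ x) ℚ./ e ℚ.≤ (ℤ.+ y) ℚ./ e ℚ.+ ℕ→ℚ t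
  half x y le = begin
    (ℤ.+ x) ℚ./ e                          ≤⟨ /-cross-≤ x (y + t) e e (*-monoˡ-≤ e le) ⟩
    (ℤ.+ (y + t)) ℚ./ e                    ≡⟨ trans (cong (ℚ._/ e) (ℤ.pos-+ y t)) (/-+ (ℤ.+ y) (ℤ.+ t) e) ⟩
    (ℤ.+ y) ℚ./ e ℚ.+ (ℤ.+ t) ℚ./ e        ≤⟨ ℚ.+-monoʳ-≤ ((ℤ.+ y) ℚ./ e) (/-cross-≤ t t e 1 (*-monoʳ-≤ t (>-nonZero⁻¹ e))) ⟩
    (ℤ.+ y) ℚ./ e ℚ.+ ℕ→ℚ t                ∎

-- The covariance

/-scale : ∀ x y e .{{_ : NonZero e}} → ((ℤ.+ x) ℚ./ e) ℚ.* ℕ→ℚ y ≡ (ℤ.+ (x * y)) ℚ./ e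
/-scale x y e = trans (/-* (ℤ.+ x) (ℤ.+ y) e 1) (trans
  (cong (λ i → (i ℚ./ (e * 1)) {{m*n≢0 e 1}}) (sym (ℤ.pos-* x y)))
  (/-cross (x * y) (x * y) (e * 1) e {{m*n≢0 e 1}} (cong (x * y *_) (sym (*-identityʳ e)))))

module _ {k : ℕ} (π₁ π₂ : Permutation′ (suc k)) where

  private
    m e B A⁴ W² : ℕ
    m = suc k
    e = suc (k + k)
    B = bracketSum π₁ π₂
    A⁴ = m ! * m ! * (m ! * m !)
    W² = e ! * e !

    instance
      A²≢0 : NonZero (m ! * m !)
      A²≢0 = m !* m !≢0
      A⁴≢0 : NonZero A⁴
      A⁴≢0 = m*n≢0 (m ! * m !) (m ! * m !)
      W²≢0 : NonZero W²
      W²≢0 = e !* e !≢0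

  remainder/n! : ℕ → ℚ
  remainder/n! n = ((ℤ.+ remainder {n = n} π₁ π₂) ℚ./ (n !)) {{n !≢0}}

  -- The term `n P′ (m + m)` over `A⁴` arises both from the disjoint pairs and, through `P′*P′`,
  -- from the product of the means. It is the only part of degree 2m, and it cancels exactly.
  Cov-closed : ∀ {n} d → m + m + d ≡ n → Cov π₁ π₂ n ≡
    ((ℤ.+ (B * (n P′ e))) ℚ./ W² ℚ.+ remainder/n! n) ℚ.- (ℤ.+ gap n m m) ℚ./ A⁴
  Cov-closed {n} d 2m+d≡n = trans (cong₂ ℚ._-_ E₁₂ E₁E₂)
    (cancel ((ℤ.+ (n P′ (m + m))) ℚ./ A⁴) ((ℤ.+ (B * (n P′ e))) ℚ./ W²) (remainder/n! n) ((ℤ.+ gap n m m) ℚ./ A⁴))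
    where
    open ≡-Reasoning
    instance _ = n !≢0
    U V R p : ℕ
    U = disjointPart π₁ π₂ d 2m+d≡n
    V = meetPart π₁ π₂ d 2m+d≡n
    R = remainder {n = n} π₁ π₂
    p = n P′ (m + m)

    E₁₂ : E n (λ τ → X π₁ τ * X π₂ τ) ≡ (ℤ.+ p) ℚ./ A⁴ ℚ.+ (ℤ.+ (B * (n P′ e))) ℚ./ W² ℚ.+ remainder/n! n
    E₁₂ = begin
      E n (λ τ → X π₁ τ * X π₂ τ)
        ≡⟨ cong (λ s → (ℤ.+ s) ℚ./ (n !)) (trans (sum-Sym n _) (sum-XX π₁ π₂ d 2m+d≡n)) ⟩
      (ℤ.+ (U + V + R)) ℚ./ (n !)
        ≡⟨ trans (cong (ℚ._/ (n !)) (ℤ.pos-+ (U + V) R)) (/-+ (ℤ.+ (U + V)) (ℤ.+ R) (n !)) ⟩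
      (ℤ.+ (U + V)) ℚ./ (n !) ℚ.+ remainder/n! n
        ≡⟨ cong (ℚ._+ remainder/n! n) (trans (cong (ℚ._/ (n !)) (ℤ.pos-+ U V)) (/-+ (ℤ.+ U) (ℤ.+ V) (n !))) ⟩
      (ℤ.+ U) ℚ./ (n !) ℚ.+ (ℤ.+ V) ℚ./ (n !) ℚ.+ remainder/n! n
        ≡⟨ cong (ℚ._+ remainder/n! n) (cong₂ ℚ._+_
             (/-cross U p (n !) A⁴ (disjointPart-closed π₁ π₂ d 2m+d≡n))
             (/-cross V (B * (n P′ e)) (n !) W² (meetPart-closed π₁ π₂ d 2m+d≡n))) ⟩
      (ℤ.+ p) ℚ./ A⁴ ℚ.+ (ℤ.+ (B * (n P′ e))) ℚ./ W² ℚ.+ remainder/n! n ∎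

    E-X : ∀ π → E n (X π) ≡ (ℤ.+ (n P′ m)) ℚ./ (m ! * m !)
    E-X π = trans (cong (λ s → (ℤ.+ s) ℚ./ (n !)) (sum-Sym n (X π)))
      -- A single occurrence prescribes only `m` values, leaving `m + d` positions free.
      (/-cross (∑ˢ n (X π)) (n P′ m) (n !) (m ! * m !) (sum-X-closed (m + d) (trans (sym (+-assoc m m d)) 2m+d≡n) π))

    E₁E₂ : E n (X π₁) ℚ.* E n (X π₂) ≡ (ℤ.+ p) ℚ./ A⁴ ℚ.+ (ℤ.+ gap n m m) ℚ./ A⁴
    E₁E₂ = begin
      E n (X π₁) ℚ.* E n (X π₂)
        ≡⟨ cong₂ ℚ._*_ (E-X π₁) (E-X π₂) ⟩
      ((ℤ.+ (n P′ m)) ℚ./ (m ! * m !)) ℚ.* ((ℤ.+ (n P′ m)) ℚ./ (m ! * m !))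
        ≡⟨ /-* (ℤ.+ (n P′ m)) (ℤ.+ (n P′ m)) (m ! * m !) (m ! * m !) ⟩
      (ℤ.+ (n P′ m) ℤ.* ℤ.+ (n P′ m)) ℚ./ A⁴
        ≡⟨ cong (ℚ._/ A⁴) (trans (sym (ℤ.pos-* (n P′ m) (n P′ m)))
             (cong ℤ.+_ (P′*P′ n m m (≤-trans (m≤m+n (m + m) d) (≤-reflexive 2m+d≡n))))) ⟩
      (ℤ.+ (p + gap n m m)) ℚ./ A⁴
        ≡⟨ trans (cong (ℚ._/ A⁴) (ℤ.pos-+ p (gap n m m))) (/-+ (ℤ.+ p) (ℤ.+ gap n m m) A⁴) ⟩
      (ℤ.+ p) ℚ./ A⁴ ℚ.+ (ℤ.+ gap n m m) ℚ./ A⁴ ∎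

    open ℚ-Solver.+-*-Solver using (solve; _:+_; _:-_; _:=_)
    cancel : ∀ p q r s → (p ℚ.+ q ℚ.+ r) ℚ.- (p ℚ.+ s) ≡ (q ℚ.+ r) ℚ.- s
    cancel = solve 4 (λ p q r s → (p :+ q :+ r) :- (p :+ s) := (q :+ r) :- s) refl

  2m∸1 : 2 * m ∸ 1 ≡ e
  2m∸1 = trans (+-suc k (k + 0)) (cong (λ x → suc (k + x)) (+-identityʳ k))

  -- Since `mid` times (m-1)! m! is (2m-1)! and m! is m times (m-1)!, the square of `mid` over `W²`
  -- equals `m * m` over `A⁴`, the leading coefficient of the gap term.
  c-closed : c π₁ π₂ ≡ (ℤ.+ B) ℚ./ W² ℚ.- (ℤ.+ (m * m)) ℚ./ A⁴
  c-closed = trans (at (2 * m ∸ 1) 2m∸1) (trans (/-− (ℤ.+ trace) (ℤ.+ (mid ^ 2)) W²)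
    (cong₂ (λ x y → (ℤ.+ x) ℚ./ W² ℚ.- y) (trace≡bracketSum π₁ π₂) (/-cross (mid ^ 2) (m * m) W² A⁴ mid-closed)))
    where
    mid trace : ℕ
    mid = e C k
    trace = Tr (A m ⊗ (P π₁ ⊗ (A m ⊗ Pinv π₂)))
    -- The exponent is generalised to a variable because it also occurs in the proof that the
    -- denominator is nonzero.
    at : ∀ s → s ≡ e →
      (((ℤ.+ trace) ℤ.- (ℤ.+ ((s C k) ^ 2))) ℚ./ (s ! * s !)) {{s !* s !≢0}} ≡
      ((ℤ.+ trace) ℤ.- (ℤ.+ (mid ^ 2))) ℚ./ W²
    at s refl = refl
    mid-! : mid * (k ! * m !) ≡ e !
    mid-! = subst (λ s → (s C k) * (k ! * m !) ≡ s !) (+-suc k k) (C*!*!≡! k m)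
    mid-closed : mid ^ 2 * A⁴ ≡ m * m * W²
    mid-closed = trans (regroup m mid (k !)) (cong (λ x → m * m * (x * x)) mid-!)
      where
      regroup : ∀ m x h → x * (x * 1) * (m * h * (m * h) * (m * h * (m * h))) ≡ m * m * (x * (h * (m * h)) * (x * (h * (m * h))))
      regroup = solve-∀

  -- The constant m^4 counts the choices of the four indices. Positivity of `n` permits cancelling
  -- `n * n`, the two factors saved by the coincidences.
  #meetTwice≤ : ∀ n → 1 ≤ n → #meetTwice m m n ≤ m * m * m * m * n ^ (k + k)
  #meetTwice≤ n@(suc _) _ = *-cancelˡ-≤ (n * n) (≤-trans (#meetTwice-bound m m n) (≤-reflexive (trans
    (regroup m n (n ^ k)) (cong (λ x → n * n * (m * m * m * m * x)) (sym (^-distribˡ-+-* n k k))))))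
    where
    regroup : ∀ m n x → n * x * (m * (m * (m * (m * (n * x))))) ≡ n * n * (m * m * m * m * (x * x))
    regroup = solve-∀

  ∣remainder/n!∣≤ : ∀ n → ℚ.∣ remainder/n! n ∣ ℚ.≤ ℕ→ℚ (#meetTwice m m n)
  ∣remainder/n!∣≤ n = ℚ.≤-trans
    (ℚ.≤-reflexive (ℚ.0≤p⇒∣p∣≡p (/-cross-≤ 0 R 1 (n !) z≤n)))
    (/-cross-≤ R (#meetTwice m m n) (n !) 1 (≤-trans (≤-reflexive (*-identityʳ R)) (remainder≤ {n = n} π₁ π₂)))
    where
    instance _ = n !≢0
    R : ℕ
    R = remainder {n = n} π₁ π₂

  open Leads

  meetLeads : Leads (λ n → B * (n P′ e)) (B * 1) (k + k)
  meetLeads = leads-* B (leads-P′ (k + k))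

  gapLeads : Leads (λ n → gap n m m) (m * m) (k + k)
  gapLeads = leads-gap k k

  K : ℕ
  K = error meetLeads + m * m * m * m + error gapLeads

  -- Subtracting the main term pairs each closed form with its own leading term, `b` with `b′` and
  -- `g` with `g′`, and leaves the remainder alone. The triangle inequality then adds three errors,
  -- one for each summand of `K`.
  Cov-asymptotic : ∀ n → m + m ≤ n → ℚ.∣ Cov π₁ π₂ n ℚ.- c π₁ π₂ ℚ.* ℕ→ℚ (n ^ e) ∣ ℚ.≤ ℕ→ℚ K ℚ.* ℕ→ℚ (n ^ (k + k))
  Cov-asymptotic n 2m≤n = begin
    ℚ.∣ Cov π₁ π₂ n ℚ.- c π₁ π₂ ℚ.* ℕ→ℚ N ∣
      ≡⟨ cong ℚ.∣_∣ difference ⟩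
    ℚ.∣ ((b ℚ.- b′) ℚ.+ remainder/n! n) ℚ.- (g ℚ.- g′) ∣
      ≤⟨ ℚ.∣p-q∣≤∣p∣+∣q∣ ((b ℚ.- b′) ℚ.+ remainder/n! n) (g ℚ.- g′) ⟩
    ℚ.∣ (b ℚ.- b′) ℚ.+ remainder/n! n ∣ ℚ.+ ℚ.∣ g ℚ.- g′ ∣
      ≤⟨ ℚ.+-monoˡ-≤ ℚ.∣ g ℚ.- g′ ∣ (ℚ.∣p+q∣≤∣p∣+∣q∣ (b ℚ.- b′) (remainder/n! n)) ⟩
    ℚ.∣ b ℚ.- b′ ∣ ℚ.+ ℚ.∣ remainder/n! n ∣ ℚ.+ ℚ.∣ g ℚ.- g′ ∣
      ≤⟨ ℚ.+-mono-≤ (ℚ.+-mono-≤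
           (/-difference (B * (n P′ e)) (B * N) W² (≤-trans (proj₁ meetBounds) (≤-reflexive (cong (λ x → x * N + t₁) (*-identityʳ B))))
             (≤-trans (≤-reflexive (cong (_* N) (sym (*-identityʳ B)))) (proj₂ meetBounds)))
           (ℚ.≤-trans (∣remainder/n!∣≤ n) (/-cross-≤ (#meetTwice m m n) t₂ 1 1 (*-monoˡ-≤ 1 (#meetTwice≤ n 1≤n)))))
           (/-difference (gap n m m) (m * m * N) A⁴ (proj₁ gapBounds) (proj₂ gapBounds)) ⟩
    ℕ→ℚ t₁ ℚ.+ ℕ→ℚ t₂ ℚ.+ ℕ→ℚ t₃
      ≡⟨ sym (trans (ℕ→ℚ-+ (t₁ + t₂) t₃) (cong (ℚ._+ ℕ→ℚ t₃) (ℕ→ℚ-+ t₁ t₂))) ⟩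
    ℕ→ℚ (t₁ + t₂ + t₃)
      ≡⟨ cong ℕ→ℚ (collect (error meetLeads) (m * m * m * m) (error gapLeads) (n ^ (k + k))) ⟩
    ℕ→ℚ (K * n ^ (k + k))
      ≡⟨ ℕ→ℚ-* K (n ^ (k + k)) ⟩
    ℕ→ℚ K ℚ.* ℕ→ℚ (n ^ (k + k)) ∎
    where
    open ℚ.≤-Reasoning
    N t₁ t₂ t₃ : ℕ
    N = n ^ e
    t₁ = error meetLeads * n ^ (k + k)
    t₂ = m * m * m * m * n ^ (k + k)
    t₃ = error gapLeads * n ^ (k + k)
    b b′ g g′ : ℚ
    b  = (ℤ.+ (B * (n P′ e))) ℚ./ W²
    b′ = (ℤ.+ (B * N)) ℚ./ W²
    g  = (ℤ.+ gap n m m) ℚ./ A⁴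
    g′ = (ℤ.+ (m * m * N)) ℚ./ A⁴
    1≤n : 1 ≤ n
    1≤n = ≤-trans (s≤s z≤n) 2m≤n
    meetBounds = bounds meetLeads n 1≤n
    gapBounds = bounds gapLeads n 1≤n
    collect : ∀ x y z w → x * w + y * w + z * w ≡ (x + y + z) * w
    collect = solve-∀
    open ℚ-Solver.+-*-Solver using (solve; _:+_; _:-_; _:*_; _:=_)
    regroup : ∀ b r g β μ N → ((b ℚ.+ r) ℚ.- g) ℚ.- (β ℚ.- μ) ℚ.* N ≡ ((b ℚ.- β ℚ.* N) ℚ.+ r) ℚ.- (g ℚ.- μ ℚ.* N)
    regroup = solve 6 (λ b r g β μ N → ((b :+ r) :- g) :- (β :- μ) :* N := ((b :- β :* N) :+ r) :- (g :- μ :* N)) refl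
    difference : Cov π₁ π₂ n ℚ.- c π₁ π₂ ℚ.* ℕ→ℚ N ≡ ((b ℚ.- b′) ℚ.+ remainder/n! n) ℚ.- (g ℚ.- g′)
    difference = trans
      (cong₂ (λ x y → x ℚ.- y ℚ.* ℕ→ℚ N) (Cov-closed (n ∸ (m + m)) (m+[n∸m]≡n 2m≤n)) c-closed)
      (trans (regroup b (remainder/n! n) g ((ℤ.+ B) ℚ./ W²) ((ℤ.+ (m * m)) ℚ./ A⁴) (ℕ→ℚ N))
        (cong₂ (λ x y → ((b ℚ.- x) ℚ.+ remainder/n! n) ℚ.- (g ℚ.- y)) (/-scale B N W²) (/-scale (m * m) N A⁴)))

theorem4p4 : (m : ℕ) → 1 < m → (π₁ π₂ : Permutation′ m) →
    (Tr (A m ⊗ (P π₁ ⊗ (A m ⊗ Pinv π₂))) ≡ bracketSum π₁ π₂)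
    × (∃[ K ] ∃[ N ] ((n : ℕ) → N ≤ n →
    ℚ.∣ Cov π₁ π₂ n ℚ.- c π₁ π₂ ℚ.* ℕ→ℚ (n ^ (2 * m ∸ 1)) ∣
    ℚ.≤ K ℚ.* ℕ→ℚ (n ^ (2 * m ∸ 2))))
-- From the threshold `m + m` on, `n ∸ (m + m)` serves as the number `d` of free positions that the
-- exact formula for the covariance requires.
theorem4p4 m@(suc k) _ π₁ π₂ = trace≡bracketSum π₁ π₂ , ℕ→ℚ (K π₁ π₂) , m + m , λ n 2m≤n →
  subst₂ (λ s t → ℚ.∣ Cov π₁ π₂ n ℚ.- c π₁ π₂ ℚ.* ℕ→ℚ (n ^ s) ∣ ℚ.≤ ℕ→ℚ (K π₁ π₂) ℚ.* ℕ→ℚ (n ^ t))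
    (sym (2m∸1 π₁ π₂)) (cong (_∸ 1) (sym (2m∸1 π₁ π₂))) (Cov-asymptotic π₁ π₂ n 2m≤n)
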